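{- Let $F$ be an algebraically closed field of odd characteristic and let $\mathcal{C}\subset\mathcal{Q}_n$ be an $F$-linear subspace such that every non-zero $Q\in\mathcal{C}$ has $\operatorname{wt}(Q)\ge 3$. Then $\dim_F(\mathcal{C})\le n(n+1)/2-(4n-6)$.
   Context: $\mathcal{Q}_n$ is the $F$-vector space of homogeneous polynomials of degree $2$ in $x_1,\ldots,x_n$ over $F$, and $\mathcal{L}_n$ the space of homogeneous polynomials of degree $1$. The weight $\operatorname{wt}(Q)$ of a non-zero $Q\in\mathcal{Q}_n$ is the smallest $k$ such that $Q=\ell_1\ell_1'+\cdots+\ell_k\ell_k'$ with $\ell_i,\ell_i'\in\mathcal{L}_n$. -}

module Defs where

open import Level using (Level; _⊔_)
open import Algebra.Bundles using (CommutativeRing)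
open import Data.Nat as ℕ using (ℕ; zero; suc)
open import Data.Nat.Primality using (Prime)
open import Data.Fin as Fin using (Fin; zero; suc; _≟_)
open import Data.Integer as ℤ using (ℤ; +_)
open import Data.Product using (Σ; ∃; _×_; _,_)
open import Relation.Nullary using (¬_; yes; no)
open import Relation.Binary.PropositionalEquality using (_≡_)

record Field (c ℓ : Level) : Set (Level.suc (c ⊔ ℓ)) where
  field
    commRing : CommutativeRing c ℓ
  open CommutativeRing commRing public
  field
    1≉0     : ¬ (1# ≈ 0#)
    inverse : ∀ x → ¬ (x ≈ 0#) → ∃ λ y → x * y ≈ 1#

module _ {c ℓ : Level} (F : Field c ℓ) where
  open Field F using (Carrier; _≈_; _+_; _*_; 0#; 1#)

  Σ[<_] : (k : ℕ) → (Fin k → Carrier) → Carrier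
  Σ[< zero ] f = 0#
  Σ[< suc k ] f = f zero + Σ[< k ] (λ t → f (suc t))

  pow : Carrier → ℕ → Carrier
  pow x zero = 1#
  pow x (suc m) = x * pow x m

  ℕ→F : ℕ → Carrier
  ℕ→F zero = 0#
  ℕ→F (suc m) = 1# + ℕ→F m

  AlgClosed : Set (c ⊔ ℓ)
  AlgClosed = ∀ (d : ℕ) (cs : Fin (suc d) → Carrier) →
    ∃ λ x → pow x (suc d) + Σ[< suc d ] (λ i → cs i * pow x (Fin.toℕ i)) ≈ 0#

  -- Odd characteristic: the characteristic is an odd prime p
  -- (for a prime p, p·1 = 0 in a field means char F = p).
  OddCharacteristic : Set ℓ
  OddCharacteristic = Σ ℕ λ p → Prime p × ¬ (p ≡ 2) × (ℕ→F p ≈ 0#)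

  Lin : ℕ → Set c
  Lin n = Fin n → Carrier

  -- Quadratic forms (homogeneous of degree 2) in x_1..x_n:
  -- Q i j is the coefficient of the monomial x_i x_j, only meaningful for i ≤ j.
  Quad : ℕ → Set c
  Quad n = Fin n → Fin n → Carrier

  _≈Q_ : ∀ {n} → Quad n → Quad n → Set ℓ
  _≈Q_ {n} P Q = ∀ (i j : Fin n) → i Fin.≤ j → P i j ≈ Q i j

  0Q : ∀ {n} → Quad n
  0Q i j = 0#

  _+Q_ : ∀ {n} → Quad n → Quad n → Quad n
  (P +Q Q) i j = P i j + Q i j

  _·Q_ : ∀ {n} → Carrier → Quad n → Quad n
  (a ·Q Q) i j = a * Q i j

  ΣQ : ∀ {n} (k : ℕ) → (Fin k → Quad n) → Quad n
  ΣQ k Qs i j = Σ[< k ] (λ t → Qs t i j)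

  mulLin : ∀ {n} → Lin n → Lin n → Quad n
  mulLin l l' i j with i ≟ j
  ... | yes _ = l i * l' i
  ... | no  _ = l i * l' j + l j * l' i

  SumOfProducts : ∀ {n} → ℕ → Quad n → Set (c ⊔ ℓ)
  SumOfProducts {n} k Q =
    Σ (Fin k → Lin n) λ ls → Σ (Fin k → Lin n) λ ls' →
      Q ≈Q ΣQ k (λ t → mulLin (ls t) (ls' t))

  WtGe : ∀ {n} → ℕ → Quad n → Set (c ⊔ ℓ)
  WtGe m Q = ∀ k → k ℕ.< m → ¬ SumOfProducts k Q

  record IsSubspace {p} (n : ℕ) (C : Quad n → Set p) : Set (c ⊔ ℓ ⊔ p) where
    field
      respects : ∀ {P Q} → P ≈Q Q → C P → C Q
      has-0    : C 0Q
      closed-+ : ∀ {P Q} → C P → C Q → C (P +Q Q)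
      closed-· : ∀ a {Q} → C Q → C (a ·Q Q)

  LinIndep : ∀ {n} k → (Fin k → Quad n) → Set (c ⊔ ℓ)
  LinIndep {n} k Qs = ∀ (λs : Fin k → Carrier) →
    ΣQ k (λ t → λs t ·Q Qs t) ≈Q 0Q → ∀ t → λs t ≈ 0#

  DimLe : ∀ {p n} → (C : Quad n → Set p) → ℤ → Set (c ⊔ ℓ ⊔ p)
  DimLe {n = n} C d = ∀ (k : ℕ) (Qs : Fin k → Quad n) →
    (∀ t → C (Qs t)) → LinIndep k Qs → + k ℤ.≤ d

bound8p1 : ℕ → ℤ
bound8p1 n = + (n ℕ.* suc n ℕ./ 2) ℤ.- (+ (4 ℕ.* n) ℤ.- + 6)

{-# OPTIONS --safe #-}
module Submission where

open import Defs
import Algebra.Properties.Ring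
import Algebra.Properties.Semiring.Mult.TCOptimised
import Algebra.Solver.Ring
import Algebra.Solver.Ring.AlmostCommutativeRing as ACR
open import Data.Empty using (⊥; ⊥-elim)
open import Data.Fin using (Fin; zero; suc; toℕ; fromℕ; inject₁; splitAt; _↑ʳ_; #_)
import Data.Fin as Fin
open import Data.Fin.Properties using (toℕ<n; toℕ-fromℕ; toℕ-inject₁; toℕ-↑ˡ; toℕ-↑ʳ; join-splitAt)
open import Data.Integer using (ℤ; +_; -[1+_]; _⊖_)
import Data.Integer as ℤ
import Data.Integer.Properties as ℤₚ
import Data.Integer.Solver
open import Data.List
  using (List; []; _∷_; _++_; map; length; lookup; concatMap; tabulate; allFin; cartesianProduct)
open import Data.List.Membership.Propositional using (_∈_)
open import Data.List.Membership.Propositional.Properties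
  using (∈-allFin; ∈-cartesianProduct⁺; ∈-map⁺; ∈-++⁺ˡ; ∈-++⁺ʳ)
open import Data.List.Properties using (length-map; length-++; length-tabulate)
open import Data.List.Relation.Unary.All using (All; []; _∷_)
import Data.List.Relation.Unary.All as All
import Data.List.Relation.Unary.All.Properties as Allₚ
open import Data.List.Relation.Unary.Any using (here; there)
open import Data.Maybe using (Maybe; just; nothing)
open import Data.Nat using (ℕ; zero; suc; z≤n; s≤s)
import Data.Nat as ℕ
open import Data.Nat.Divisibility using (_∣_; divides; _∣0)
import Data.Nat.DivMod as DivMod
open import Data.Nat.Primality using (prime⇒irreducible)
import Data.Nat.Properties as ℕₚ
import Data.Nat.Solver
open import Data.Product using (Σ; ∃; ∃₂; _×_; _,_; proj₁; proj₂; uncurry)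
open import Data.Sum using (_⊎_; inj₁; inj₂; [_,_]′)
open import Data.Unit using (⊤; tt)
open import Level using (Level; _⊔_; Lift; lift; lower)
open import Relation.Binary.PropositionalEquality using (_≡_)
import Relation.Binary.PropositionalEquality as ≡
open import Relation.Nullary using (¬_; yes; no)
open import Relation.Nullary.Decidable using (decidable-stable)

-- The symmetric matrices of rank at most 4 form a cone V of dimension 4n − 6 (for n ≥ 3), and a form with
-- matrix in V is a sum of four scaled squares, hence of two products of linear forms. A space of codimension
-- less than 4n − 6 is cut out by m < 4n − 6 linear forms, so it remains to find a non-zero point of V on m
-- hyperplanes. Let S be the homogeneous coordinate ring of V, that is, the graded ring of functions on V
-- generated by the matrix entries.
--
-- Lower bound: evaluate monomials in the 4n − 6 entries on or above the diagonal of the first four rows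
-- along a curve t ↦ L D Lᵀ whose entries are powers of t. They become monic in t, and with superincreasing
-- exponents their degrees are distinct; so dim S_d grows like d^(4n−7).
-- Upper bound: from dim (S/K)_d ≤ dim (S/K)_{d−1} + dim (S/(K + lS))_d it follows that if S/(l₁, …, l_m)
-- vanished in some degree, then dim S_d would be O(d^(m−1)). Hence it vanishes in no degree.
-- Nullstellensatz: if S/K vanishes in no degree, then for any two elements p, b of degree 1 some member of
-- their pencil can be added to K without losing this property. Adding such members makes all generators
-- proportional modulo K, and the factors of proportionality are the coordinates of the point.
-- Rank: the point satisfies the relation that four successive Schur complements vanish.
--
-- The conclusion is decidable, so all case distinctions are made in the double-negation monad.

-- The double-negation monad.

infixl 1 _>>=_

_>>=_ : ∀ {a b} {A : Set a} {B : Set b} → ¬ ¬ A → (A → ¬ ¬ B) → ¬ ¬ B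
(m >>= f) k = m λ x → f x k

return : ∀ {a} {A : Set a} → A → ¬ ¬ A
return x k = k x

lem : ∀ {a} (A : Set a) → ¬ ¬ (A ⊎ ¬ A)
lem A k = k (inj₂ λ x → k (inj₁ x))

-- Double negations can be collected in this way over a finite index set only, which is why
-- `relations` and `Kills` keep theirs inside the quantifier.
¬¬-Fin : ∀ {p} n {P : Fin n → Set p} → (∀ i → ¬ ¬ P i) → ¬ ¬ (∀ i → P i)
¬¬-Fin zero    h = return λ ()
¬¬-Fin (suc n) h = h zero >>= λ p → ¬¬-Fin n (λ i → h (suc i)) >>= λ ps →
  return λ { zero → p ; (suc i) → ps i }

-- A ring solver with integer coefficients, and division in a field.

module FieldSolver {c ℓ : Level} (F : Field c ℓ) where
  open Field F hiding (zero)
  open Algebra.Properties.Ring ring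
  open Algebra.Properties.Semiring.Mult.TCOptimised semiring
    renaming (_×_ to _×′_)
  open import Relation.Binary.Reasoning.Setoid setoid

  private
    ⟦_⟧ℤ : ℤ → Carrier
    ⟦ + n ⟧ℤ      = n ×′ 1#
    ⟦ -[1+ n ] ⟧ℤ = - (suc n ×′ 1#)

    neg-homo : ∀ i → ⟦ ℤ.- i ⟧ℤ ≈ - ⟦ i ⟧ℤ
    neg-homo (+ zero)    = sym -0#≈0#
    neg-homo (ℤ.+[1+ n ]) = refl
    neg-homo -[1+ n ]    = sym (-‿involutive _)

    cancel₁ : ∀ x y → (1# + x) - (1# + y) ≈ x - y
    cancel₁ x y = begin
      (1# + x) - (1# + y)     ≈⟨ +-cong (+-comm _ _) (sym (-‿+-comm 1# y)) ⟩
      (x + 1#) + (- 1# - y)   ≈⟨ +-assoc _ _ _ ⟩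
      x + (1# + (- 1# - y))   ≈⟨ +-congˡ (sym (+-assoc _ _ _)) ⟩
      x + ((1# - 1#) - y)     ≈⟨ +-congˡ (+-congʳ (-‿inverseʳ _)) ⟩
      x + (0# - y)            ≈⟨ +-congˡ (+-identityˡ _) ⟩
      x - y                   ∎

    ⊖-homo : ∀ m n → ⟦ m ⊖ n ⟧ℤ ≈ m ×′ 1# - n ×′ 1#
    ⊖-homo m zero = sym (trans (+-congˡ -0#≈0#) (+-identityʳ _))
    ⊖-homo zero (suc n) = sym (+-identityˡ _)
    ⊖-homo (suc m) (suc n) = begin
      ⟦ suc m ⊖ suc n ⟧ℤ                ≡⟨ ≡.cong ⟦_⟧ℤ (ℤₚ.[1+m]⊖[1+n]≡m⊖n m n) ⟩
      ⟦ m ⊖ n ⟧ℤ                        ≈⟨ ⊖-homo m n ⟩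
      m ×′ 1# - n ×′ 1#                 ≈⟨ cancel₁ _ _ ⟨
      (1# + m ×′ 1#) - (1# + n ×′ 1#)   ≈⟨ +-cong (1+× m 1#) (-‿cong (1+× n 1#)) ⟨
      suc m ×′ 1# - suc n ×′ 1#         ∎

    plus-homo : ∀ i j → ⟦ i ℤ.+ j ⟧ℤ ≈ ⟦ i ⟧ℤ + ⟦ j ⟧ℤ
    plus-homo (+ m) (+ n)       = ×-homo-+ 1# m n
    plus-homo (+ m) -[1+ n ]    = ⊖-homo m (suc n)
    plus-homo -[1+ m ] (+ n)    = trans (⊖-homo n (suc m)) (+-comm _ _)
    plus-homo -[1+ m ] -[1+ n ] = begin
      - (suc (suc (m ℕ.+ n)) ×′ 1#)     ≡⟨ ≡.cong (λ k → - (k ×′ 1#)) (≡.sym (ℕₚ.+-suc (suc m) n)) ⟩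
      - ((suc m ℕ.+ suc n) ×′ 1#)       ≈⟨ -‿cong (×-homo-+ 1# (suc m) (suc n)) ⟩
      - (suc m ×′ 1# + suc n ×′ 1#)     ≈⟨ -‿+-comm _ _ ⟨
      - (suc m ×′ 1#) - suc n ×′ 1#     ∎

    *-pos : ∀ m n → ⟦ + m ℤ.* + n ⟧ℤ ≈ ⟦ + m ⟧ℤ * ⟦ + n ⟧ℤ
    *-pos m n = trans (reflexive (≡.cong ⟦_⟧ℤ (≡.sym (ℤₚ.pos-* m n)))) (×1-homo-* m n)

    times-neg : ∀ i j → ⟦ i ℤ.* j ⟧ℤ ≈ ⟦ i ⟧ℤ * ⟦ j ⟧ℤ → ⟦ i ℤ.* ℤ.- j ⟧ℤ ≈ ⟦ i ⟧ℤ * ⟦ ℤ.- j ⟧ℤ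
    times-neg i j h = begin
      ⟦ i ℤ.* ℤ.- j ⟧ℤ      ≡⟨ ≡.cong ⟦_⟧ℤ (≡.sym (ℤₚ.neg-distribʳ-* i j)) ⟩
      ⟦ ℤ.- (i ℤ.* j) ⟧ℤ    ≈⟨ neg-homo (i ℤ.* j) ⟩
      - ⟦ i ℤ.* j ⟧ℤ        ≈⟨ -‿cong h ⟩
      - (⟦ i ⟧ℤ * ⟦ j ⟧ℤ)   ≈⟨ -‿distribʳ-* _ _ ⟩
      ⟦ i ⟧ℤ * - ⟦ j ⟧ℤ     ≈⟨ *-congˡ (neg-homo j) ⟨
      ⟦ i ⟧ℤ * ⟦ ℤ.- j ⟧ℤ   ∎

    times-comm : ∀ i j → ⟦ i ℤ.* j ⟧ℤ ≈ ⟦ i ⟧ℤ * ⟦ j ⟧ℤ → ⟦ j ℤ.* i ⟧ℤ ≈ ⟦ j ⟧ℤ * ⟦ i ⟧ℤ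
    times-comm i j h = trans (reflexive (≡.cong ⟦_⟧ℤ (ℤₚ.*-comm j i))) (trans h (*-comm _ _))

    times-pos : ∀ m j → ⟦ + m ℤ.* j ⟧ℤ ≈ ⟦ + m ⟧ℤ * ⟦ j ⟧ℤ
    times-pos m (+ n)    = *-pos m n
    times-pos m -[1+ n ] = times-neg (+ m) (+ suc n) (*-pos m (suc n))

    times-homo : ∀ i j → ⟦ i ℤ.* j ⟧ℤ ≈ ⟦ i ⟧ℤ * ⟦ j ⟧ℤ
    times-homo (+ m) j    = times-pos m j
    times-homo -[1+ m ] j = times-comm j -[1+ m ]
      (times-neg j (+ suc m) (times-comm (+ suc m) j (times-pos (suc m) j)))

    morphism : ℤ.+-*-rawRing ACR.-Raw-AlmostCommutative⟶ ACR.fromCommutativeRing commRing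
    morphism = record
      { ⟦_⟧ = ⟦_⟧ℤ ; +-homo = plus-homo ; *-homo = times-homo ; -‿homo = neg-homo
      ; 0-homo = refl ; 1-homo = refl }

    -- Distinct integers may have the same image in positive characteristic, so unequal coefficients
    -- give no answer rather than a negative one.
    ≟-weak : ∀ i j → Maybe (⟦ i ⟧ℤ ≈ ⟦ j ⟧ℤ)
    ≟-weak i j with i ℤ.≟ j
    ... | yes p = just (reflexive (≡.cong ⟦_⟧ℤ p))
    ... | no  _ = nothing

  open Algebra.Solver.Ring ℤ.+-*-rawRing (ACR.fromCommutativeRing commRing) morphism ≟-weak public
    using (solve; _:+_; _:*_; _:-_; :-_; _:=_; con)

module FieldLemmas {c ℓ : Level} (F : Field c ℓ) where
  open Field F hiding (zero)
  open FieldSolver F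

  divide : ∀ {x} → ¬ x ≈ 0# → ∀ y → ∃ λ z → z * x ≈ y
  divide {x} x≉0 y with inverse x x≉0
  ... | w , xw≈1 = y * w , trans (*-assoc y w x) (trans (*-congˡ (trans (*-comm w x) xw≈1)) (*-identityʳ y))

  cancel-nonzero : ∀ {x y} → ¬ x ≈ 0# → y * x ≈ 0# → y ≈ 0#
  cancel-nonzero {x} {y} x≉0 yx≈0 with divide x≉0 1#
  ... | z , zx≈1 = trans (sym (*-identityʳ y)) (trans (*-congˡ (sym zx≈1))
          (trans (solve 3 (λ y z x → y :* (z :* x) := z :* (y :* x)) refl y z x)
            (trans (*-congˡ yx≈0) (zeroʳ z))))

  difference-zero : ∀ {x y} → x - y ≈ 0# → x ≈ y
  difference-zero {x} {y} h =
    trans (solve 2 (λ x y → x := (x :- y) :+ y) refl x y) (trans (+-congʳ h) (+-identityˡ y))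

-- Linear combinations and dependence modulo a subspace.

module LinearAlgebra {c ℓ : Level} (F : Field c ℓ) {a : Level} (Ix : Set a) where
  open Field F hiding (zero)
  open FieldSolver F
  open FieldLemmas F

  Fn : Set (a ⊔ c)
  Fn = Ix → Carrier

  infix 4 _≐_
  _≐_ : Fn → Fn → Set (a ⊔ ℓ)
  f ≐ g = ∀ x → f x ≈ g x

  record Subspace : Set (Level.suc (a ⊔ c ⊔ ℓ)) where
    field
      mem   : Fn → Set (a ⊔ c ⊔ ℓ)
      ∈-rsp : ∀ {f g} → f ≐ g → mem f → mem g
      ∈-zer : mem (λ _ → 0#)
      ∈-add : ∀ {f g} → mem f → mem g → mem (λ x → f x + g x)
      ∈-scl : ∀ b {f} → mem f → mem (λ x → b * f x)

  open Subspace

  zeroSubspace : Subspace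
  zeroSubspace = record
    { mem   = λ f → Lift c (f ≐ λ _ → 0#)
    ; ∈-rsp = λ { e (lift h) → lift λ x → trans (sym (e x)) (h x) }
    ; ∈-zer = lift λ x → refl
    ; ∈-add = λ { (lift h) (lift k) → lift λ x → trans (+-cong (h x) (k x)) (+-identityˡ 0#) }
    ; ∈-scl = λ { b (lift h) → lift λ x → trans (*-congˡ (h x)) (zeroʳ b) } }

  -- LC K gs f : f is congruent modulo K to a linear combination of gs.
  LC : Subspace → List Fn → Fn → Set (a ⊔ c ⊔ ℓ)
  LC K []       f = mem K f
  LC K (g ∷ gs) f = ∃ λ b → LC K gs (λ x → f x - b * g x)

  module _ (K : Subspace) where

    LC-rsp : ∀ gs {f g} → f ≐ g → LC K gs f → LC K gs g
    LC-rsp []       e h       = ∈-rsp K e h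
    LC-rsp (g ∷ gs) e (b , h) = b , LC-rsp gs (λ x → +-congʳ (e x)) h

    LC-mem : ∀ gs {f} → mem K f → LC K gs f
    LC-mem []       h = h
    LC-mem (g ∷ gs) {f} h = 0# ,
      LC-rsp gs (λ x → solve 2 (λ f g → f := f :- con (+ 0) :* g) refl (f x) (g x)) (LC-mem gs h)

    LC-zer : ∀ gs → LC K gs (λ _ → 0#)
    LC-zer gs = LC-mem gs (∈-zer K)

    LC-add : ∀ gs {f g} → LC K gs f → LC K gs g → LC K gs (λ x → f x + g x)
    LC-add [] h k = ∈-add K h k
    LC-add (g ∷ gs) {f₁} {f₂} (b₁ , h₁) (b₂ , h₂) = b₁ + b₂ ,
      LC-rsp gs (λ x → solve 5 (λ f₁ f₂ b₁ b₂ g → (f₁ :- b₁ :* g) :+ (f₂ :- b₂ :* g) := (f₁ :+ f₂) :- (b₁ :+ b₂) :* g)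
                 refl (f₁ x) (f₂ x) b₁ b₂ (g x)) (LC-add gs h₁ h₂)

    LC-scl : ∀ gs b {f} → LC K gs f → LC K gs (λ x → b * f x)
    LC-scl [] b h = ∈-scl K b h
    LC-scl (g ∷ gs) b {f} (b₁ , h₁) = b * b₁ ,
      LC-rsp gs (λ x → solve 4 (λ b f b₁ g → b :* (f :- b₁ :* g) := b :* f :- (b :* b₁) :* g)
                 refl b (f x) b₁ (g x)) (LC-scl gs b h₁)

    LC-sub : ∀ gs b {f g} → LC K gs f → LC K gs g → LC K gs (λ x → f x - b * g x)
    LC-sub gs b {f} {g} h k =
      LC-rsp gs (λ x → solve 3 (λ f b g → f :+ (:- b) :* g := f :- b :* g) refl (f x) b (g x))
        (LC-add gs h (LC-scl gs (- b) k))

    LC-unsub : ∀ gs b {f g} → LC K gs (λ x → f x - b * g x) → LC K gs g → LC K gs f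
    LC-unsub gs b {f} {g} h k =
      LC-rsp gs (λ x → solve 3 (λ f b g → (f :- b :* g) :+ b :* g := f) refl (f x) b (g x))
        (LC-add gs h (LC-scl gs b k))

    LC-weaken : ∀ g gs {f} → LC K gs f → LC K (g ∷ gs) f
    LC-weaken g gs {f} h = 0# ,
      LC-rsp gs (λ x → solve 2 (λ f g → f := f :- con (+ 0) :* g) refl (f x) (g x)) h

    LC-head : ∀ g gs → LC K (g ∷ gs) g
    LC-head g gs = 1# ,
      LC-rsp gs (λ x → solve 1 (λ g → con (+ 0) := g :- con (+ 1) :* g) refl (g x)) (LC-zer gs)

    LC-trans : ∀ {gs} hs → All (LC K hs) gs → ∀ {f} → LC K gs f → LC K hs f
    LC-trans hs []       k       = LC-mem hs k
    LC-trans hs (p ∷ ps) (b , k) = LC-unsub hs b (LC-trans hs ps k) p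

    LC-self : ∀ gs → All (LC K gs) gs
    LC-self []       = []
    LC-self (g ∷ gs) = LC-head g gs ∷ All.map (λ {f} → LC-weaken g gs {f}) (LC-self gs)

    LC-++ : ∀ gs {hs} {f g} → LC K gs f → LC K hs g → LC K (gs ++ hs) (λ x → f x + g x)
    LC-++ [] {hs} h k = LC-add hs (LC-mem hs h) k
    LC-++ (g₁ ∷ gs) {hs} {f} {g} (b , h) k = b ,
      LC-rsp (gs ++ hs) (λ x → solve 4 (λ f b g₁ g → (f :- b :* g₁) :+ g := (f :+ g) :- b :* g₁) refl (f x) b (g₁ x) (g x))
        (LC-++ gs h k)

    -- The dependent member enters with coefficient 1. This later makes a relation between powers a
    -- monic form, and a relation between quadratic forms a non-trivial one.
    Dep : List Fn → Set (a ⊔ c ⊔ ℓ)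
    Dep []       = Lift _ ⊥
    Dep (f ∷ fs) = LC K fs f ⊎ Dep fs

    private
      -- The outcome of Gaussian elimination of g: a member of the span of fs that involves g is the
      -- pivot, and multiples of it have been subtracted from the others until g no longer occurs in
      -- them.
      record Eliminated (g : Fn) (gs fs : List Fn) : Set (a ⊔ c ⊔ ℓ) where
        field
          rest      : List Fn
          rest-len  : suc (length rest) ≡ length fs
          rest-LC   : All (LC K gs) rest
          rest⊂     : All (LC K fs) rest
          rest-Dep  : Dep rest → Dep fs
          pivot     : Fn
          pivot∈    : LC K fs pivot
          coeff     : Carrier
          coeff≉0   : ¬ coeff ≈ 0#
          pivot-LC  : LC K gs (λ x → pivot x - coeff * g x)

      eliminate : ∀ g gs fs → All (LC K (g ∷ gs)) fs → ¬ ¬ (All (LC K gs) fs ⊎ Eliminated g gs fs)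
      eliminate g gs [] [] = return (inj₁ [])
      eliminate g gs (f ∷ fs) ((b , h) ∷ hs) = eliminate g gs fs hs >>= λ
        { (inj₁ all) → lem (b ≈ 0#) >>= λ
            { (inj₁ b≈0) → return (inj₁ (LC-rsp gs (λ x → trans (+-congˡ (-‿cong (trans (*-congʳ b≈0) (zeroˡ (g x)))))
                 (solve 1 (λ f → f :- con (+ 0) := f) refl (f x))) h ∷ all))
            ; (inj₂ b≉0) → return (inj₂ record
                 { rest = fs ; rest-len = ≡.refl ; rest-LC = all
                 ; rest⊂ = All.map (λ {f′} → LC-weaken f fs {f′}) (LC-self fs) ; rest-Dep = inj₂
                 ; pivot = f ; pivot∈ = LC-head f fs ; coeff = b ; coeff≉0 = b≉0 ; pivot-LC = h }) }
        ; (inj₂ E) → let open Eliminated E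
                         d , dc≈b = divide coeff≉0 b
                         f′ = λ x → f x - d * pivot x
                     in return (inj₂ record
                 { rest = f′ ∷ rest
                 ; rest-len = ≡.cong suc rest-len
                 ; rest-LC = LC-rsp gs (λ x → trans
                      (solve 6 (λ f b g d p e → (f :- b :* g) :- d :* (p :- e :* g) := (f :- d :* p) :+ (d :* e :- b) :* g)
                        refl (f x) b (g x) d (pivot x) coeff)
                      (trans (+-congˡ (*-congʳ (trans (+-congʳ dc≈b) (-‿inverseʳ b))))
                        (solve 2 (λ f g → f :+ con (+ 0) :* g := f) refl (f′ x) (g x))))
                      (LC-sub gs d h pivot-LC) ∷ rest-LC
                 ; rest⊂ = LC-sub (f ∷ fs) d {f} {pivot} (LC-head f fs) (LC-weaken f fs {pivot} pivot∈)
                           ∷ All.map (λ {f′} → LC-weaken f fs {f′}) rest⊂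
                 ; rest-Dep = λ { (inj₁ k) → inj₁ (LC-unsub fs d {f} {pivot} (LC-trans fs rest⊂ k) pivot∈)
                                ; (inj₂ k) → inj₂ (rest-Dep k) }
                 ; pivot = pivot ; pivot∈ = LC-weaken f fs {pivot} pivot∈ ; coeff = coeff ; coeff≉0 = coeff≉0
                 ; pivot-LC = pivot-LC }) }

    steinitz : ∀ gs fs → All (LC K gs) fs → length gs ℕ.< length fs → ¬ ¬ Dep fs
    steinitz [] (f ∷ fs) (h ∷ _) _ = return (inj₁ (LC-mem fs h))
    steinitz (g ∷ gs) fs hs lt = eliminate g gs fs hs >>= λ
      { (inj₁ all) → steinitz gs fs all (ℕₚ.<-trans ℕₚ.≤-refl lt)
      ; (inj₂ E) → let open Eliminated E in
          steinitz gs rest rest-LC (ℕₚ.≤-pred (≡.subst (suc (suc (length gs)) ℕ.≤_) (≡.sym rest-len) lt))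
            >>= λ k → return (rest-Dep k) }

  record Functional : Set (a ⊔ c ⊔ ℓ) where
    field
      apply : Fn → Carrier
      sub   : ∀ f b g → apply (λ x → f x - b * g x) ≈ apply f - b * apply g

  record Pivot (φ : Functional) (fs : List Fn) (K : Subspace) : Set (a ⊔ c ⊔ ℓ) where
    open Functional φ
    field
      pivot     : Fn
      pivot∈    : LC K fs pivot
      pivot≉0   : ¬ apply pivot ≈ 0#
      rest      : List Fn
      rest-len  : suc (length rest) ≡ length fs
      rest-zero : All (λ f → apply f ≈ 0#) rest
      rest-span : All (LC K (pivot ∷ rest)) fs

  -- Subtracting multiples of one element on which φ is non-zero clears the values of φ on all
  -- others: passing to the kernel of φ costs one element.
  split : ∀ K φ fs → ¬ ¬ (All (λ f → Functional.apply φ f ≈ 0#) fs ⊎ Pivot φ fs K)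
  split K φ [] = return (inj₁ [])
  split K φ (f ∷ fs) = split K φ fs >>= λ
    { (inj₁ all) → lem (apply f ≈ 0#) >>= λ
       { (inj₁ z) → return (inj₁ (z ∷ all))
       ; (inj₂ nz) → return (inj₂ record
           { pivot = f ; pivot∈ = LC-head K f fs ; pivot≉0 = nz ; rest = fs ; rest-len = ≡.refl
           ; rest-zero = all ; rest-span = LC-self K (f ∷ fs) }) }
    ; (inj₂ P) → let open Pivot P
                     d , e = divide pivot≉0 (apply f)
                     f′ = λ x → f x - d * pivot x
                     insert : ∀ {h} → LC K (pivot ∷ rest) h → LC K (pivot ∷ f′ ∷ rest) h
                     insert = λ { (b , k) → b , LC-weaken K f′ rest k }
                 in return (inj₂ record
           { pivot = pivot ; pivot∈ = LC-weaken K f fs {pivot} pivot∈ ; pivot≉0 = pivot≉0 ; rest = f′ ∷ rest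
           ; rest-len = ≡.cong suc rest-len
           ; rest-zero = trans (sub f d pivot) (trans (+-congˡ (-‿cong e)) (-‿inverseʳ (apply f))) ∷ rest-zero
           ; rest-span = (d , LC-head K f′ rest) ∷ All.map (λ {h} → insert {h}) rest-span }) }
    where open Functional φ

  LC-zero : ∀ (φ : Functional) gs {f} → LC zeroSubspace gs f → All (λ g → Functional.apply φ g ≈ 0#) gs →
    (∀ {g} → g ≐ (λ _ → 0#) → Functional.apply φ g ≈ 0#) → Functional.apply φ f ≈ 0#
  LC-zero φ [] (lift h) [] φ0 = φ0 h
  LC-zero φ (g ∷ gs) {f} (b , h) (z ∷ zs) φ0 =
    trans (solve 2 (λ x y → x := (x :- y) :+ y) refl (apply f) (b * apply g))
      (trans (+-cong (trans (sym (sub f b g)) (LC-zero φ gs h zs φ0)) (trans (*-congˡ z) (zeroʳ b))) (+-identityˡ 0#))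
    where open Functional φ

module _ {c ℓ : Level} (F : Field c ℓ) {a a′ : Level} {Ix : Set a} {Ix′ : Set a′} where
  open Field F hiding (zero)
  private
    module A = LinearAlgebra F Ix
    module B = LinearAlgebra F Ix′

  LC-image : (T : A.Fn → B.Fn) → (∀ {f} → f A.≐ (λ _ → 0#) → T f B.≐ (λ _ → 0#)) →
    (∀ f b g → T (λ x → f x - b * g x) B.≐ (λ x → T f x - b * T g x)) →
    ∀ gs {f} → A.LC A.zeroSubspace gs f → B.LC B.zeroSubspace (map T gs) (T f)
  LC-image T T0 T- [] (lift h) = lift (T0 h)
  LC-image T T0 T- (g ∷ gs) {f} (b , h) = b , B.LC-rsp B.zeroSubspace (map T gs) (T- f b g) (LC-image T T0 T- gs h)

-- Arithmetic for the growth of Hilbert functions.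

module NatLemmas where
  open import Data.Nat using (_+_; _*_; _^_; _≤_)
  open Data.Nat.Solver.+-*-Solver using (solve; _:=_; _:+_; _:*_)

  +-exchange : ∀ a b c → a + (b + c) ≡ b + (a + c)
  +-exchange = solve 3 (λ a b c → a :+ (b :+ c) := b :+ (a :+ c)) ≡.refl

  -- The induction step of `hilbert-growth`: the first term bounds the preceding degree, the second
  -- the quotient by one more linear form.
  growth-step : ∀ C a j → C * a ^ suc j + C * suc a ^ j ≤ C * suc a ^ suc j
  growth-step C a j = begin
    C * (a * a ^ j) + C * suc a ^ j
      ≤⟨ ℕₚ.+-monoˡ-≤ _ (ℕₚ.*-monoʳ-≤ C (ℕₚ.*-monoʳ-≤ a (ℕₚ.^-monoˡ-≤ j (ℕₚ.n≤1+n a)))) ⟩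
    C * (a * suc a ^ j) + C * suc a ^ j
      ≡⟨ solve 3 (λ C a x → C :* (a :* x) :+ C :* x := C :* (x :+ a :* x)) ≡.refl C a (suc a ^ j) ⟩
    C * (suc a * suc a ^ j) ∎
    where open ℕₚ.≤-Reasoning

-- Binary forms and their factorisation.

module BinaryForms {c ℓ : Level} (F : Field c ℓ) where
  open Field F hiding (zero)
  open FieldSolver F
  open FieldLemmas F

  infixr 8 _^_
  _^_ : Carrier → ℕ → Carrier
  x ^ m = pow F x m

  1^ : ∀ m → 1# ^ m ≈ 1#
  1^ zero    = refl
  1^ (suc m) = trans (*-identityˡ _) (1^ m)

  ^-+ : ∀ x m k → x ^ (m ℕ.+ k) ≈ x ^ m * x ^ k
  ^-+ x zero    k = sym (*-identityˡ _)
  ^-+ x (suc m) k = trans (*-congˡ (^-+ x m k)) (sym (*-assoc _ _ _))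

  -- The binary form Σ aₜ pᵗ bᵐ⁻¹⁻ᵗ of degree m − 1 with coefficients a₀, …, aₘ₋₁.
  form : List Carrier → Carrier → Carrier → Carrier
  form []       p b = 0#
  form (a ∷ as) p b = p * form as p b + a * b ^ length as

  -- `form` recurses on the coefficient of the pure power of b, whereas `powers-form` has to adjoin
  -- the coefficient of the pure power of p.
  form-snoc : ∀ as a p b → form (as ++ a ∷ []) p b ≈ b * form as p b + a * p ^ length as
  form-snoc []       a p b = solve 3 (λ a p b → p :* con (+ 0) :+ a :* con (+ 1) := b :* con (+ 0) :+ a :* con (+ 1)) refl a p b
  form-snoc (a′ ∷ as) a p b = trans
    (+-cong (*-congˡ (form-snoc as a p b))
      (*-congˡ (reflexive (≡.cong (b ^_) (≡.trans (length-++ as) (ℕₚ.+-comm (length as) 1))))))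
    (solve 7 (λ p b f a P a′ B → p :* (b :* f :+ a :* P) :+ a′ :* (b :* B) := b :* (p :* f :+ a′ :* B) :+ a :* (p :* P))
      refl p b (form as p b) a (p ^ length as) a′ (b ^ length as))

  -- The binary form of degree m = `length as` with coefficient 1 at p^m; the factor b lifts the
  -- remaining terms from degree m - 1 to degree m.
  monic : List Carrier → Carrier → Carrier → Carrier
  monic as p b = p ^ length as - b * form as p b

  -- Synthetic division, made homogeneous, so that the remainder is a multiple of a power of b. The
  -- remainder r for the tail supplies the new coefficient `- r` of the quotient that is lowest in
  -- p.
  divideLinear : ∀ x a as → ∃₂ λ as′ r → length as′ ≡ length as ×
    (∀ p b → monic (a ∷ as) p b ≈ (p - x * b) * monic as′ p b + r * b ^ suc (length as))
  divideLinear x a [] = [] , x - a , ≡.refl , λ p b →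
    solve 4 (λ p b x a → p :* con (+ 1) :- b :* (p :* con (+ 0) :+ a :* con (+ 1))
        := (p :- x :* b) :* (con (+ 1) :- b :* con (+ 0)) :+ (x :- a) :* (b :* con (+ 1))) refl p b x a
  divideLinear x a (a₁ ∷ as) with divideLinear x a₁ as
  ... | as′ , r , len , eq = (- r) ∷ as′ , x * r - a , ≡.cong suc len , λ p b →
    trans (solve 5 (λ p b P f s → p :* P :- b :* (p :* f :+ s) := p :* (P :- b :* f) :- b :* s)
             refl p b (p ^ suc (length as)) (form (a₁ ∷ as) p b) (a * b ^ suc (length as)))
    (trans (+-congʳ (*-congˡ (eq p b)))
    (trans (solve 8 (λ p b x H P r B a → p :* ((p :- x :* b) :* (P :- b :* H) :+ r :* (b :* B)) :- b :* (a :* (b :* B))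
              := (p :- x :* b) :* (p :* P :- b :* (p :* H :+ (:- r) :* B)) :+ (x :* r :- a) :* (b :* (b :* B)))
             refl p b x (form as′ p b) (p ^ length as′) r (b ^ length as) a)
      (+-congʳ (*-congˡ (+-congˡ (-‿cong (*-congˡ (+-congˡ (*-congˡ (reflexive (≡.cong (b ^_) (≡.sym len))))))))))))

  Σ-scale : ∀ k x (f g : Fin k → Carrier) → Σ[<_] F k (λ i → f i * (x * g i)) ≈ x * Σ[<_] F k (λ i → f i * g i)
  Σ-scale zero    x f g = sym (zeroʳ x)
  Σ-scale (suc k) x f g = trans (+-congˡ (Σ-scale k x (λ i → f (suc i)) (λ i → g (suc i))))
    (solve 4 (λ f x g s → f :* (x :* g) :+ x :* s := x :* (f :* g :+ s)) refl (f zero) x (g zero) _)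

  -- At b = 1 a form becomes the sum to which `AlgClosed` applies; the signs are negative because
  -- `monic` subtracts its form.
  Σ-form : ∀ as x → Σ[<_] F (length as) (λ i → (- lookup as i) * x ^ toℕ i) ≈ - form as x 1#
  Σ-form []       x = solve 0 (con (+ 0) := :- con (+ 0)) refl
  Σ-form (a ∷ as) x = trans
    (+-congˡ (trans (Σ-scale (length as) x (λ i → - lookup as i) (λ i → x ^ toℕ i)) (*-congˡ (Σ-form as x))))
    (trans (solve 3 (λ a x f → (:- a) :* con (+ 1) :+ x :* (:- f) := :- (x :* f :+ a :* con (+ 1))) refl a x (form as x 1#))
      (-‿cong (+-congˡ (*-congˡ (sym (1^ (length as)))))))

  productOfLinear : List Carrier → Carrier → Carrier → Carrier
  productOfLinear []       p b = 1#
  productOfLinear (x ∷ xs) p b = (p - x * b) * productOfLinear xs p b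

  module _ (closed : AlgClosed F) where

    root : ∀ a as → ∃ λ x → monic (a ∷ as) x 1# ≈ 0#
    root a as with closed (length as) (λ i → - lookup (a ∷ as) i)
    ... | x , eq = x , trans (+-congˡ (trans (-‿cong (*-identityˡ _)) (sym (Σ-form (a ∷ as) x)))) eq

    splits : ∀ m as → length as ≡ m → ∃ λ xs → length xs ≡ m × (∀ p b → monic as p b ≈ productOfLinear xs p b)
    splits zero [] _ = [] , ≡.refl , λ p b → solve 1 (λ b → con (+ 1) :- b :* con (+ 0) := con (+ 1)) refl b
    splits (suc m) (a ∷ as) len with root a as
    ... | x , isRoot with divideLinear x a as
    ... | as′ , r , len′ , eq with splits m as′ (≡.trans len′ (ℕₚ.suc-injective len))
    ... | xs , lenxs , eqs = x ∷ xs , ≡.cong suc lenxs , λ p b →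
      trans (eq p b) (trans (+-cong (*-congˡ (eqs p b)) (trans (*-congʳ r≈0) (zeroˡ _))) (+-identityʳ _))
      where
      -- At p = x and b = 1 the linear factor vanishes, and only r remains of the division identity.
      r≈0 : r ≈ 0#
      r≈0 = trans (solve 3 (λ r x H → r := (x :- x :* con (+ 1)) :* H :+ r :* con (+ 1)) refl r x (monic as′ x 1#))
        (trans (+-congˡ (*-congˡ (sym (1^ (suc (length as)))))) (trans (sym (eq x 1#)) isRoot))

-- The graded algebra of functions and its homogeneous ideals.

module GradedAlgebra {c ℓ : Level} (F : Field c ℓ) (closed : AlgClosed F) {V : Set c}
    {G : Set} (gens : List G) (complete : ∀ k → k ∈ gens) (q : G → V → Field.Carrier F) where
  open Field F hiding (zero)
  open FieldSolver F
  open FieldLemmas F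
  open BinaryForms F
  open LinearAlgebra F V
  open Subspace

  infixl 7 _·_
  _·_ : Fn → Fn → Fn
  (f · g) v = f v * g v

  -- The grading is by formal degree: the same function may lie in S d for several d.
  data S : ℕ → Fn → Set (c ⊔ ℓ) where
    one : S 0 (λ _ → 1#)
    zer : ∀ {d} → S d (λ _ → 0#)
    add : ∀ {d f g} → S d f → S d g → S d (λ v → f v + g v)
    scl : ∀ {d} b {f} → S d f → S d (λ v → b * f v)
    gen : ∀ {d} k {f} → S d f → S (suc d) (q k · f)
    rsp : ∀ {d f g} → f ≐ g → S d f → S d g

  -- The parts are subspaces of the space of all functions, and only closure under the generators is
  -- demanded; closure under S follows in `ideal-mul`.
  record Ideal : Set (Level.suc (c ⊔ ℓ)) where
    field
      part  : ℕ → Subspace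
      gen-∈ : ∀ k {d f} → mem (part d) f → mem (part (suc d)) (q k · f)

    infix 4 _∋_
    _∋_ : ℕ → Fn → Set (c ⊔ ℓ)
    d ∋ f = mem (part d) f

  open Ideal

  transport : ∀ K {d e f} → d ≡ e → (K ∋ d) f → (K ∋ e) f
  transport K ≡.refl h = h

  infix 4 _⊑_
  _⊑_ : Ideal → Ideal → Set (c ⊔ ℓ)
  K ⊑ K′ = ∀ d f → (K ∋ d) f → (K′ ∋ d) f

  ⊑-trans : ∀ {K K′ K″} → K ⊑ K′ → K′ ⊑ K″ → K ⊑ K″
  ⊑-trans h k d f m = k d f (h d f m)

  S-gen : ∀ k → S 1 (q k)
  S-gen k = rsp (λ v → *-identityʳ _) (gen k one)

  S-mul : ∀ {e d s f} → S e s → S d f → S (e ℕ.+ d) (s · f)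
  S-mul one         hf = rsp (λ v → sym (*-identityˡ _)) hf
  S-mul zer         hf = rsp (λ v → sym (zeroˡ _)) zer
  S-mul (add h k)   hf = rsp (λ v → sym (distribʳ _ _ _)) (add (S-mul h hf) (S-mul k hf))
  S-mul (scl b h)   hf = rsp (λ v → sym (*-assoc _ _ _)) (scl b (S-mul h hf))
  S-mul (gen k h)   hf = rsp (λ v → sym (*-assoc _ _ _)) (gen k (S-mul h hf))
  S-mul (rsp e h)   hf = rsp (λ v → *-congʳ (e v)) (S-mul h hf)

  S-^ : ∀ {p} → S 1 p → ∀ m → S m (λ v → p v ^ m)
  S-^ h zero    = one
  S-^ h (suc m) = S-mul h (S-^ h m)

  S-sub : ∀ {d} b {f g} → S d f → S d g → S d (λ v → f v - b * g v)
  S-sub b {f} {g} h k =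
    rsp (λ v → solve 3 (λ f b g → f :+ (:- b) :* g := f :- b :* g) refl (f v) b (g v)) (add h (scl (- b) k))

  module _ (K : Ideal) where

    ideal-mul : ∀ {e d s f} → S e s → (K ∋ d) f → (K ∋ e ℕ.+ d) (s · f)
    ideal-mul {d = d} one hf = ∈-rsp (part K d) (λ v → sym (*-identityˡ _)) hf
    ideal-mul {e} {d} zer hf = ∈-rsp (part K (e ℕ.+ d)) (λ v → sym (zeroˡ _)) (∈-zer (part K (e ℕ.+ d)))
    ideal-mul {e} {d} (add h k) hf = ∈-rsp (part K (e ℕ.+ d)) (λ v → sym (distribʳ _ _ _))
      (∈-add (part K (e ℕ.+ d)) (ideal-mul h hf) (ideal-mul k hf))
    ideal-mul {e} {d} (scl b h) hf = ∈-rsp (part K (e ℕ.+ d)) (λ v → sym (*-assoc _ _ _))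
      (∈-scl (part K (e ℕ.+ d)) b (ideal-mul h hf))
    ideal-mul {e} {d} (gen k h) hf = ∈-rsp (part K (e ℕ.+ d)) (λ v → sym (*-assoc _ _ _)) (gen-∈ K k (ideal-mul h hf))
    ideal-mul {e} {d} (rsp eq h) hf = ∈-rsp (part K (e ℕ.+ d)) (λ v → *-congʳ (eq v)) (ideal-mul h hf)

    private
      -- The graded parts of K + lS. Here l counts as an element of degree 1, so it contributes
      -- nothing in degree 0.
      quotientPart : Fn → ℕ → Subspace
      quotientPart l zero = part K zero
      quotientPart l (suc d) = record
        { mem = λ f → ∃ λ s → S d s × (K ∋ suc d) (λ v → f v - l v * s v)
        ; ∈-rsp = λ { eq (s , hs , h) → s , hs , ∈-rsp Kd (λ v → +-congʳ (eq v)) h }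
        ; ∈-zer = (λ _ → 0#) , zer , ∈-rsp Kd (λ v → solve 1 (λ l → con (+ 0) := con (+ 0) :- l :* con (+ 0)) refl (l v)) (∈-zer Kd)
        ; ∈-add = λ { {f} {g} (s , hs , h) (t , ht , k) → (λ v → s v + t v) , add hs ht ,
            ∈-rsp Kd (λ v → solve 5 (λ f g l s t → (f :- l :* s) :+ (g :- l :* t) := (f :+ g) :- l :* (s :+ t))
                     refl (f v) (g v) (l v) (s v) (t v)) (∈-add Kd h k) }
        ; ∈-scl = λ { b {f} (s , hs , h) → (λ v → b * s v) , scl b hs ,
            ∈-rsp Kd (λ v → solve 4 (λ b f l s → b :* (f :- l :* s) := b :* f :- l :* (b :* s))
                     refl b (f v) (l v) (s v)) (∈-scl Kd b h) } }
        where Kd = part K (suc d)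

      quotientGen : ∀ l k d {f} → mem (quotientPart l d) f → mem (quotientPart l (suc d)) (q k · f)
      quotientGen l k zero {f} h = (λ _ → 0#) , zer ,
        ∈-rsp (part K 1) (λ v → solve 2 (λ f l → f := f :- l :* con (+ 0)) refl (q k v * f v) (l v)) (gen-∈ K k h)
      quotientGen l k (suc d) {f} (s , hs , h) = q k · s , gen k hs ,
        ∈-rsp (part K (suc (suc d))) (λ v → solve 4 (λ q f l s → q :* (f :- l :* s) := q :* f :- l :* (q :* s))
              refl (q k v) (f v) (l v) (s v)) (gen-∈ K k h)

    infixl 6 _⊕_
    _⊕_ : Fn → Ideal
    _⊕_ l = record { part = quotientPart l ; gen-∈ = λ k {d} → quotientGen l k d }

  ⊑-⊕ : ∀ K l → K ⊑ K ⊕ l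
  ⊑-⊕ K l zero    f h = h
  ⊑-⊕ K l (suc d) f h = (λ _ → 0#) , zer ,
    ∈-rsp (part K (suc d)) (λ v → solve 2 (λ f l → f := f :- l :* con (+ 0)) refl (f v) (l v)) h

  ∈-⊕ : ∀ K l → ((K ⊕ l) ∋ 1) l
  ∈-⊕ K l = (λ _ → 1#) , one ,
    ∈-rsp (part K 1) (λ v → solve 1 (λ l → con (+ 0) := l :- l :* con (+ 1)) refl (l v)) (∈-zer (part K 1))

  -- Degrees in which S/K vanishes, and upper bounds for its Hilbert function.

  Vanishes : Ideal → ℕ → Set (c ⊔ ℓ)
  Vanishes K d = ∀ f → S d f → (K ∋ d) f

  NonVanishing : Ideal → Set (c ⊔ ℓ)
  NonVanishing K = ∀ d → ¬ Vanishes K d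

  vanishing-degree : ∀ K → ¬ NonVanishing K → ¬ ¬ ∃ (Vanishes K)
  vanishing-degree K h k = h λ d v → k (d , v)

  -- S is generated in degree 1: elements of degree d + 1 are combinations of generators times
  -- elements of degree d.
  vanishes-suc : ∀ K d → Vanishes K d → Vanishes K (suc d)
  vanishes-suc K d h f zer       = ∈-zer (part K (suc d))
  vanishes-suc K d h _ (add s t) = ∈-add (part K (suc d)) (vanishes-suc K d h _ s) (vanishes-suc K d h _ t)
  vanishes-suc K d h _ (scl b s) = ∈-scl (part K (suc d)) b (vanishes-suc K d h _ s)
  vanishes-suc K d h _ (gen k s) = gen-∈ K k (h _ s)
  vanishes-suc K d h _ (rsp e s) = ∈-rsp (part K (suc d)) e (vanishes-suc K d h _ s)

  vanishes-+ : ∀ K d → Vanishes K d → ∀ e → Vanishes K (e ℕ.+ d)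
  vanishes-+ K d h zero    = h
  vanishes-+ K d h (suc e) = vanishes-suc K (e ℕ.+ d) (vanishes-+ K d h e)

  vanishes-≤ : ∀ K {d e} → d ℕ.≤ e → Vanishes K d → Vanishes K e
  vanishes-≤ K {d} {e} le h = ≡.subst (Vanishes K) (ℕₚ.m∸n+n≡m le) (vanishes-+ K d h (e ℕ.∸ d))

  -- An upper bound for dim (S/K)_d; the spanning functions themselves need not belong to S.
  HilbertLe : Ideal → ℕ → ℕ → Set (c ⊔ ℓ)
  HilbertLe K d k = ∃ λ gs → length gs ℕ.≤ k × (∀ f → S d f → LC (part K d) gs f)

  hilbert-mono : ∀ K d {k k′} → k ℕ.≤ k′ → HilbertLe K d k → HilbertLe K d k′
  hilbert-mono K d le (gs , len , h) = gs , ℕₚ.≤-trans len le , h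

  LC-map : ∀ {K K′} s → (∀ f → mem K f → mem K′ (s · f)) → ∀ gs {f} → LC K gs f → LC K′ (map (s ·_) gs) (s · f)
  LC-map s T [] h = T _ h
  LC-map {K} {K′} s T (g ∷ gs) {f} (b , h) = b ,
    LC-rsp K′ (map (s ·_) gs) (λ v → solve 4 (λ s f b g → s :* (f :- b :* g) := s :* f :- b :* (s :* g)) refl (s v) (f v) b (g v))
      (LC-map {K} {K′} s T gs h)

  private
    spanning : ℕ → List Fn
    spanning zero    = (λ _ → 1#) ∷ []
    spanning (suc d) = concatMap (λ k → map (q k ·_) (spanning d)) gens

    LC-concatMap : ∀ K (hs : G → List Fn) {ks k} → k ∈ ks → ∀ {f} → LC K (hs k) f → LC K (concatMap hs ks) f
    LC-concatMap K hs {k ∷ ks} (here ≡.refl) {f} h =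
      LC-rsp K (hs k ++ concatMap hs ks) (λ v → +-identityʳ (f v)) (LC-++ K (hs k) h (LC-zer K (concatMap hs ks)))
    LC-concatMap K hs {k ∷ ks} (there k∈) {f} h =
      LC-rsp K (hs k ++ concatMap hs ks) (λ v → +-identityˡ (f v)) (LC-++ K (hs k) (LC-zer K (hs k)) (LC-concatMap K hs k∈ h))

    S-spanned : ∀ K d f → S d f → LC (part K d) (spanning d) f
    S-spanned K zero _ one = LC-head (part K 0) (λ _ → 1#) []
    S-spanned K d _ zer = LC-zer (part K d) (spanning d)
    S-spanned K d _ (add s t) = LC-add (part K d) (spanning d) (S-spanned K d _ s) (S-spanned K d _ t)
    S-spanned K d _ (scl b s) = LC-scl (part K d) (spanning d) b (S-spanned K d _ s)
    S-spanned K (suc d) _ (gen k s) = LC-concatMap (part K (suc d)) (λ k → map (q k ·_) (spanning d)) (complete k)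
      (LC-map {part K d} {part K (suc d)} (q k) (λ f → gen-∈ K k) (spanning d) (S-spanned K d _ s))
    S-spanned K d _ (rsp e s) = LC-rsp (part K d) (spanning d) e (S-spanned K d _ s)

    hilbert-finite : ∀ K d₀ → ∃ λ C → ∀ d → d ℕ.≤ d₀ → HilbertLe K d C
    hilbert-finite K zero = 1 , λ { zero z≤n → spanning 0 , ℕₚ.≤-refl , S-spanned K 0 }
    hilbert-finite K (suc d₀) with hilbert-finite K d₀
    ... | C , h = C ℕ.+ length (spanning (suc d₀)) , λ d le → [
        (λ d<  → hilbert-mono K d (ℕₚ.m≤m+n C _) (h d (ℕₚ.≤-pred d<))) ,
        (λ { ≡.refl → spanning (suc d₀) , ℕₚ.m≤n+m _ C , S-spanned K (suc d₀) }) ]′ (ℕₚ.m≤n⇒m<n∨m≡n le)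

    LC-quotient : ∀ K l d gs {f} → LC (part (K ⊕ l) (suc d)) gs f →
      ∃ λ s → S d s × LC (part K (suc d)) gs (λ v → f v - l v * s v)
    LC-quotient K l d [] h = h
    LC-quotient K l d (g ∷ gs) {f} (b , h) with LC-quotient K l d gs h
    ... | s , hs , k = s , hs , b , LC-rsp (part K (suc d)) gs
      (λ v → solve 5 (λ f b g l s → (f :- b :* g) :- l :* s := (f :- l :* s) :- b :* g) refl (f v) b (g v) (l v) (s v)) k

  -- Multiplication by l maps (S/K)_d onto the kernel of the projection from (S/K)_{d+1} to (S/(K +
  -- lS))_{d+1}. So the multiples by l of a spanning list, together with a list for the quotient,
  -- span.
  hilbert-step : ∀ K {l} → S 1 l → ∀ d {k k′} → HilbertLe K d k → HilbertLe (K ⊕ l) (suc d) k′ → HilbertLe K (suc d) (k ℕ.+ k′)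
  hilbert-step K {l} hl d (gs , len , h) (gs′ , len′ , h′) =
    map (l ·_) gs ++ gs′ ,
    ℕₚ.≤-trans (ℕₚ.≤-reflexive (≡.trans (length-++ (map (l ·_) gs)) (≡.cong (ℕ._+ length gs′) (length-map _ gs)))) (ℕₚ.+-mono-≤ len len′) ,
    λ f hf → let s , hs , k = LC-quotient K l d gs′ (h′ f hf) in
      LC-rsp (part K (suc d)) (map (l ·_) gs ++ gs′)
        (λ v → solve 2 (λ f p → p :+ (f :- p) := f) refl (f v) (l v * s v))
        (LC-++ (part K (suc d)) (map (l ·_) gs)
          (LC-map {part K d} {part K (suc d)} l (λ f → ideal-mul K hl) gs (h s hs)) k)

  -- Beyond degree d₀ the quotient by l contributes nothing, so `hilbert-step` adds the empty list
  -- and the dimension stops growing.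
  hilbert-bounded : ∀ K {l} → S 1 l → ∀ d₀ → Vanishes (K ⊕ l) d₀ → ∃ λ C → ∀ d → HilbertLe K d C
  hilbert-bounded K {l} hl d₀ van with hilbert-finite K d₀
  ... | C , h = C , bound
    where
    bound : ∀ d → HilbertLe K d C
    bound zero = h 0 z≤n
    bound (suc d) with suc d ℕ.≤? d₀
    ... | yes le = h (suc d) le
    ... | no ¬le = ≡.subst (HilbertLe K (suc d)) (ℕₚ.+-identityʳ C)
          (hilbert-step K hl d (bound d) ([] , z≤n , vanishes-≤ (K ⊕ l) (ℕₚ.<⇒≤ (ℕₚ.≰⇒> ¬le)) van))

  infixl 6 _⊕*_
  _⊕*_ : Ideal → List Fn → Ideal
  K ⊕* []       = K
  K ⊕* (l ∷ ls) = (K ⊕ l) ⊕* ls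

  ⊑-⊕* : ∀ K ls → K ⊑ K ⊕* ls
  ⊑-⊕* K []       d f h = h
  ⊑-⊕* K (l ∷ ls) d f h = ⊑-⊕* (K ⊕ l) ls d f (⊑-⊕ K l d f h)

  ∈-⊕* : ∀ K ls → All ((K ⊕* ls) ∋ 1) ls
  ∈-⊕* K []       = []
  ∈-⊕* K (l ∷ ls) = ⊑-⊕* (K ⊕ l) ls 1 l (∈-⊕ K l) ∷ ∈-⊕* (K ⊕ l) ls

  -- Induction on the number of forms: summing the bound for the quotient by l over the degrees
  -- raises the exponent by one.
  hilbert-growth : ∀ K l ls → S 1 l → All (S 1) ls → ∀ d₀ → Vanishes (K ⊕* (l ∷ ls)) d₀ →
    ∃ λ C → ∀ d → HilbertLe K d (C ℕ.* suc d ℕ.^ length ls)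
  hilbert-growth K l [] hl [] d₀ van with hilbert-bounded K hl d₀ van
  ... | C , h = C , λ d → ≡.subst (HilbertLe K d) (≡.sym (ℕₚ.*-identityʳ C)) (h d)
  hilbert-growth K l (l₁ ∷ ls) hl (hl₁ ∷ hls) d₀ van with hilbert-growth (K ⊕ l) l₁ ls hl₁ hls d₀ van
  ... | C , h = C , bound
    where
    bound : ∀ d → HilbertLe K d (C ℕ.* suc d ℕ.^ suc (length ls))
    -- K and `K ⊕ l` have the same part in degree 0, so the bound for the quotient serves for K.
    bound zero = hilbert-mono K 0 (ℕₚ.≤-reflexive (≡.cong (C ℕ.*_) (≡.sym (ℕₚ.*-identityˡ _)))) (h 0)
    bound (suc d) = hilbert-mono K (suc d) (NatLemmas.growth-step C (suc d) (length ls)) (hilbert-step K hl d (bound d) (h (suc d)))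

  -- Pencils of linear forms and the Nullstellensatz.

  private
    -- Surjectivity of multiplication by g from (S/K)_d to (S/K)_D.
    Absorbs : Ideal → Fn → ℕ → ℕ → Set (c ⊔ ℓ)
    Absorbs K g D d = ∀ f → S D f → ∃ λ s → S d s × (K ∋ D) (λ v → f v - g v * s v)

    absorbs-suc : ∀ K g D d → Absorbs K g D d → Absorbs K g (suc D) (suc d)
    absorbs-suc K g D d h _ zer = (λ _ → 0#) , zer ,
      ∈-rsp (part K (suc D)) (λ v → solve 1 (λ g → con (+ 0) := con (+ 0) :- g :* con (+ 0)) refl (g v)) (∈-zer (part K (suc D)))
    absorbs-suc K g D d h _ (add {f = f₁} {g = f₂} x y) with absorbs-suc K g D d h _ x | absorbs-suc K g D d h _ y
    ... | s , hs , k | t , ht , k′ = (λ v → s v + t v) , add hs ht ,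
      ∈-rsp (part K (suc D)) (λ v → solve 5 (λ f f′ g s t → (f :- g :* s) :+ (f′ :- g :* t) := (f :+ f′) :- g :* (s :+ t))
             refl (f₁ v) (f₂ v) (g v) (s v) (t v)) (∈-add (part K (suc D)) k k′)
    absorbs-suc K g D d h _ (scl b {f} x) with absorbs-suc K g D d h _ x
    ... | s , hs , k = (λ v → b * s v) , scl b hs ,
      ∈-rsp (part K (suc D)) (λ v → solve 4 (λ b f g s → b :* (f :- g :* s) := b :* f :- g :* (b :* s)) refl b (f v) (g v) (s v))
        (∈-scl (part K (suc D)) b k)
    absorbs-suc K g D d h _ (gen j {f} x) with h _ x
    ... | s , hs , k = q j · s , gen j hs ,
      ∈-rsp (part K (suc D)) (λ v → solve 4 (λ b f g s → b :* (f :- g :* s) := b :* f :- g :* (b :* s)) refl (q j v) (f v) (g v) (s v))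
        (gen-∈ K j k)
    absorbs-suc K g D d h _ (rsp e x) with absorbs-suc K g D d h _ x
    ... | s , hs , k = s , hs , ∈-rsp (part K (suc D)) (λ v → +-congʳ (e v)) k

    absorbs-+ : ∀ K g D d → Absorbs K g D d → ∀ m → Absorbs K g (m ℕ.+ D) (m ℕ.+ d)
    absorbs-+ K g D d h zero    = h
    absorbs-+ K g D d h (suc m) = absorbs-suc K g _ _ (absorbs-+ K g D d h m)

    Absorbing : Ideal → Fn → ℕ → Set (c ⊔ ℓ)
    Absorbing K g k = S k g × ¬ ¬ ∃ λ d → Absorbs K g (k ℕ.+ d) d

    absorbing-one : ∀ K → Absorbing K (λ _ → 1#) 0
    absorbing-one K = one , return (0 , λ f hf → f , hf ,
      ∈-rsp (part K 0) (λ v → solve 1 (λ f → con (+ 0) := f :- con (+ 1) :* f) refl (f v)) (∈-zer (part K 0)))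

    absorbing-rsp : ∀ K {g h k} → g ≐ h → Absorbing K g k → Absorbing K h k
    absorbing-rsp K {k = k} e (hg , n) = rsp e hg , (n >>= λ { (d , a) → return (d , λ f hf → let s , hs , m = a f hf in
      s , hs , ∈-rsp (part K (k ℕ.+ d)) (λ v → +-congˡ (-‿cong (*-congʳ (e v)))) m) })

    -- Once S/(K + lS) vanishes, multiplication by l on S/K is surjective, and surjections compose.
    absorbing-mul : ∀ K {l} → S 1 l → ¬ NonVanishing (K ⊕ l) → ∀ {g k} → Absorbing K g k → Absorbing K (l · g) (suc k)
    absorbing-mul K {l} hl nv {g} {k} (hg , n) = S-mul hl hg , (n >>= λ { (d , a) → vanishing-degree (K ⊕ l) nv >>= λ { (d₀ , van) →
      return (d₀ ℕ.+ d , λ f hf →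
        let E₁ = ≡.cong suc (NatLemmas.+-exchange d₀ k d)
            E₂ = ℕₚ.+-suc k (d₀ ℕ.+ d)
            s , hs , m = absorbs-+ K g (k ℕ.+ d) d a (suc d₀) f (≡.subst (λ D → S D f) (≡.sym E₁) hf)
            t , ht , m′ = vanishes-≤ (K ⊕ l) (ℕₚ.≤-trans (ℕₚ.m≤m+n d₀ d) (ℕₚ.n≤1+n _)) van s hs
            D = suc k ℕ.+ (d₀ ℕ.+ d)
        in t , ht , ∈-rsp (part K D)
             (λ v → solve 5 (λ f g s l t → (f :- g :* s) :+ g :* (s :- l :* t) := f :- (l :* g) :* t)
                      refl (f v) (g v) (s v) (l v) (t v))
             (∈-add (part K D) (transport K E₁ m) (transport K E₂ (ideal-mul K hg m′)))) } })

    -- If g belonged to K, multiplication by g would be zero on S/K; being surjective in some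
    -- degree, it would force S/K to vanish there.
    absorbing-∉ : ∀ K → NonVanishing K → ∀ {g k} → Absorbing K g k → ¬ (K ∋ k) g
    absorbing-∉ K nv {g} {k} (hg , n) g∈K = n λ { (d , a) → nv (k ℕ.+ d) λ f hf →
      let s , hs , m = a f hf in
      ∈-rsp (part K (k ℕ.+ d)) (λ v → solve 3 (λ f g s → (f :- g :* s) :+ s :* g := f) refl (f v) (g v) (s v))
        (∈-add (part K (k ℕ.+ d)) m (transport K (ℕₚ.+-comm d k) (ideal-mul K hs g∈K))) }

    absorbing-split : ∀ K {p b} → S 1 p → S 1 b → ¬ NonVanishing (K ⊕ b) →
      (∀ x → ¬ NonVanishing (K ⊕ (λ v → p v - x * b v))) →
      ∀ xs e → Absorbing K (λ v → productOfLinear xs (p v) (b v) * b v ^ e) (length xs ℕ.+ e)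
    absorbing-split K {p} {b} hp hb nb np [] zero = absorbing-rsp K (λ v → sym (*-identityˡ _)) (absorbing-one K)
    absorbing-split K {p} {b} hp hb nb np [] (suc e) =
      absorbing-rsp K (λ v → solve 2 (λ b B → b :* (con (+ 1) :* B) := con (+ 1) :* (b :* B)) refl (b v) (b v ^ e))
        (absorbing-mul K hb nb (absorbing-split K hp hb nb np [] e))
    absorbing-split K {p} {b} hp hb nb np (x ∷ xs) e =
      absorbing-rsp K (λ v → sym (*-assoc _ _ _))
        (absorbing-mul K (S-sub x hp hb) (np x) (absorbing-split K hp hb nb np xs e))

    -- The monomials p^i b^e, p^(i-1) b^(e+1), ..., b^(i+e). Descending powers of p make a
    -- dependence on later members monic in p.
    powers : Fn → Fn → ℕ → ℕ → List Fn
    powers p b zero    e = (λ v → b v ^ e) ∷ []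
    powers p b (suc i) e = (λ v → p v ^ suc i * b v ^ e) ∷ powers p b i (suc e)

    powers-length : ∀ p b i e → length (powers p b i e) ≡ suc i
    powers-length p b zero    e = ≡.refl
    powers-length p b (suc i) e = ≡.cong suc (powers-length p b i (suc e))

    powers-S : ∀ {p b} → S 1 p → S 1 b → ∀ i e → All (S (i ℕ.+ e)) (powers p b i e)
    powers-S hp hb zero    e = S-^ hb e ∷ []
    powers-S {p} {b} hp hb (suc i) e = S-mul (S-^ hp (suc i)) (S-^ hb e) ∷
      ≡.subst (λ D → All (S D) (powers p b i (suc e))) (ℕₚ.+-suc i e) (powers-S hp hb i (suc e))

    powers-form : ∀ K {p b} i e {f} → LC K (powers p b i e) f →
      ∃ λ as → length as ≡ suc i × mem K (λ v → f v - form as (p v) (b v) * b v ^ e)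
    powers-form K {p} {b} zero e {f} (a , h) = a ∷ [] , ≡.refl ,
      ∈-rsp K (λ v → solve 4 (λ f a B p → f :- a :* B := f :- (p :* con (+ 0) :+ a :* con (+ 1)) :* B) refl (f v) a (b v ^ e) (p v)) h
    powers-form K {p} {b} (suc i) e {f} (a , h) with powers-form K i (suc e) h
    ... | as , len , k = as ++ a ∷ [] ,
      ≡.trans (length-++ as) (≡.trans (ℕₚ.+-comm (length as) 1) (≡.cong suc len)) ,
      ∈-rsp K (λ v → trans
        (solve 6 (λ f a P B g b → (f :- a :* (P :* B)) :- g :* (b :* B) := f :- (b :* g :+ a :* P) :* B)
           refl (f v) a (p v ^ suc i) (b v ^ e) (form as (p v) (b v)) (b v))
        (+-congˡ (-‿cong (*-congʳ (trans (+-congˡ (*-congˡ (reflexive (≡.cong (p v ^_) (≡.sym len)))))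
           (sym (form-snoc as a (p v) (b v)))))))) k

    -- The dependent member and all later ones share a power of b; taking it out leaves a monic
    -- form.
    powers-dep : ∀ K {p b} i e → Dep K (powers p b i e) →
      ∃₂ λ as e′ → length as ℕ.+ e′ ≡ i ℕ.+ e × mem K (λ v → monic as (p v) (b v) * b v ^ e′)
    powers-dep K {p} {b} zero e (inj₁ h) = [] , e , ≡.refl ,
      ∈-rsp K (λ v → solve 2 (λ b B → B := (con (+ 1) :- b :* con (+ 0)) :* B) refl (b v) (b v ^ e)) h
    powers-dep K {p} {b} (suc i) e (inj₁ h) with powers-form K i (suc e) h
    ... | as , len , k = as , e , ≡.cong (ℕ._+ e) len ,
      ∈-rsp K (λ v → trans
        (solve 4 (λ P B g b → P :* B :- g :* (b :* B) := (P :- b :* g) :* B)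
           refl (p v ^ suc i) (b v ^ e) (form as (p v) (b v)) (b v))
        (*-congʳ (+-congʳ (reflexive (≡.cong (p v ^_) (≡.sym len)))))) k
    powers-dep K (suc i) e (inj₂ h) with powers-dep K i (suc e) h
    ... | as , e′ , len , k = as , e′ , ≡.trans len (ℕₚ.+-suc i e) , k

  -- If every quotient by a form of the pencil spanned by p and b vanished eventually, then S/K would have
  -- bounded dimension, a binary form in p and b would lie in K, and so would a product of members of the pencil.
  pencil : ∀ K → NonVanishing K → ∀ {p b} → S 1 p → S 1 b →
    ¬ ¬ (NonVanishing (K ⊕ b) ⊎ ∃ λ x → NonVanishing (K ⊕ (λ v → p v - x * b v)))
  pencil K nv {p} {b} hp hb none =
    (vanishing-degree (K ⊕ b) nb >>= λ { (d₀ , van) →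
      let C , h = hilbert-bounded K hb d₀ van
          gs , len , sp = h (C ℕ.+ 0)
      -- There are C + 1 monomials of degree C in p and b, one more than the bound on the dimension
      -- of S/K in that degree.
      in steinitz (part K (C ℕ.+ 0)) gs (powers p b C 0) (All.map (λ {f} → sp f) (powers-S hp hb C 0))
           (≡.subst (length gs ℕ.<_) (≡.sym (powers-length p b C 0)) (s≤s len)) >>= λ dep → return (contradict C dep) }) λ x → x
    where
    nb : ¬ NonVanishing (K ⊕ b)
    nb h = none (inj₁ h)
    np : ∀ x → ¬ NonVanishing (K ⊕ (λ v → p v - x * b v))
    np x h = none (inj₂ (x , h))
    contradict : ∀ C → Dep (part K (C ℕ.+ 0)) (powers p b C 0) → ⊥
    contradict C dep with powers-dep (part K (C ℕ.+ 0)) C 0 dep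
    ... | as , e , deg , m with splits closed (length as) as ≡.refl
    ... | xs , lenxs , eqs = absorbing-∉ K nv (absorbing-split K hp hb nb np xs e)
          (transport K (≡.trans (≡.sym deg) (≡.cong (ℕ._+ e) (≡.sym lenxs)))
            (∈-rsp (part K (C ℕ.+ 0)) (λ v → *-congʳ (eqs (p v) (b v))) m))

  -- A point of the projective variety of K in terms of coordinate rings: modulo the larger ideal
  -- every generator is a multiple of `base`, and the factors are homogeneous coordinates.
  record Point (K : Ideal) : Set (Level.suc (c ⊔ ℓ)) where
    field
      ideal : Ideal
      K⊑    : K ⊑ ideal
      nv    : NonVanishing ideal
      base  : Fn
      baseS : S 1 base
      coord : G → Carrier
      cong  : ∀ k → (ideal ∋ 1) (λ v → q k v - coord k * base v)

  nullstellensatz : ∀ K → NonVanishing K → ¬ ¬ Point K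
  nullstellensatz K nv = go gens >>= λ { (K′ , le , nv′ , b , hb , cs) → return record
      { ideal = K′ ; K⊑ = le ; nv = nv′ ; base = b ; baseS = hb
      ; coord = λ k → proj₁ (All.lookup cs (complete k)) ; cong = λ k → proj₂ (All.lookup cs (complete k)) } }
    where
    Congruent : Ideal → Fn → G → Set (c ⊔ ℓ)
    Congruent K′ b k = ∃ λ x → (K′ ∋ 1) (λ v → q k v - x * b v)
    go : ∀ ks → ¬ ¬ ∃ λ K′ → K ⊑ K′ × NonVanishing K′ × ∃ λ b → S 1 b × All (Congruent K′ b) ks
    -- The base starts as 0 and is replaced whenever the pencil yields the first alternative.
    go [] = return (K , (λ _ _ h → h) , nv , (λ _ → 0#) , zer , [])
    go (k ∷ ks) = go ks >>= λ { (K′ , le , nv′ , b , hb , cs) → pencil K′ nv′ (S-gen k) hb >>= λ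
      -- Now b itself lies in the ideal, so the earlier generators receive the coordinate 0 and
      -- `q k` becomes the base.
      { (inj₁ n) → return (K′ ⊕ b , ⊑-trans {K} {K′} {K′ ⊕ b} le (⊑-⊕ K′ b) , n , q k , S-gen k ,
          (1# , ∈-rsp (part (K′ ⊕ b) 1) (λ v → solve 1 (λ f → con (+ 0) := f :- con (+ 1) :* f) refl (q k v)) (∈-zer (part (K′ ⊕ b) 1)))
          ∷ All.map (λ { {j} (x , h) → 0# , ∈-rsp (part (K′ ⊕ b) 1)
                (λ v → solve 4 (λ f x b k → (f :- x :* b) :+ x :* b := f :- con (+ 0) :* k) refl (q j v) x (b v) (q k v))
                (∈-add (part (K′ ⊕ b) 1) (⊑-⊕ K′ b 1 _ h) (∈-scl (part (K′ ⊕ b) 1) x (∈-⊕ K′ b))) }) cs)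
      ; (inj₂ (x , n)) → let l = λ v → q k v - x * b v in
          return (K′ ⊕ l , ⊑-trans {K} {K′} {K′ ⊕ l} le (⊑-⊕ K′ l) , n , b , hb ,
          (x , ∈-⊕ K′ l) ∷ All.map (λ { (y , h) → y , ⊑-⊕ K′ l 1 _ h }) cs) } }

  -- Evaluation of forms at a point.

  module AtPoint {K : Ideal} (P : Point K) where
    open Point P

    -- Value d f a : the form f of degree d takes the value a at the point.
    Value : ℕ → Fn → Carrier → Set (c ⊔ ℓ)
    Value d f a = S d f × (ideal ∋ d) (λ v → f v - a * base v ^ d)

    value-rsp : ∀ {d f g a b} → f ≐ g → a ≈ b → Value d f a → Value d g b
    value-rsp {d} e e′ (s , h) = rsp e s , ∈-rsp (part ideal d) (λ v → +-cong (e v) (-‿cong (*-congʳ e′))) h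

    value-zer : ∀ {d} → Value d (λ _ → 0#) 0#
    value-zer {d} = zer , ∈-rsp (part ideal d) (λ v → solve 1 (λ B → con (+ 0) := con (+ 0) :- con (+ 0) :* B) refl (base v ^ d)) (∈-zer (part ideal d))

    value-one : Value 0 (λ _ → 1#) 1#
    value-one = one , ∈-rsp (part ideal 0) (λ v → solve 0 (con (+ 0) := con (+ 1) :- con (+ 1) :* con (+ 1)) refl) (∈-zer (part ideal 0))

    value-add : ∀ {d f g a b} → Value d f a → Value d g b → Value d (λ v → f v + g v) (a + b)
    value-add {d} {f} {g} {a} {b} (s , h) (t , k) = add s t , ∈-rsp (part ideal d)
      (λ v → solve 5 (λ f g a b B → (f :- a :* B) :+ (g :- b :* B) := (f :+ g) :- (a :+ b) :* B) refl (f v) (g v) a b (base v ^ d))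
      (∈-add (part ideal d) h k)

    value-scl : ∀ {d} x {f a} → Value d f a → Value d (λ v → x * f v) (x * a)
    value-scl {d} x {f} {a} (s , h) = scl x s , ∈-rsp (part ideal d)
      (λ v → solve 4 (λ x f a B → x :* (f :- a :* B) := x :* f :- (x :* a) :* B) refl x (f v) a (base v ^ d))
      (∈-scl (part ideal d) x h)

    value-mul : ∀ {d e f g a b} → Value d f a → Value e g b → Value (d ℕ.+ e) (f · g) (a * b)
    value-mul {d} {e} {f} {g} {a} {b} (s , h) (t , k) = S-mul s t , ∈-rsp (part ideal (d ℕ.+ e))
      (λ v → trans
        (solve 6 (λ f g a b B B′ → g :* (f :- a :* B) :+ a :* (B :* (g :- b :* B′)) := f :* g :- (a :* b) :* (B :* B′))
          refl (f v) (g v) a b (base v ^ d) (base v ^ e))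
        (+-congˡ (-‿cong (*-congˡ (sym (^-+ (base v) d e))))))
      (∈-add (part ideal (d ℕ.+ e)) (transport ideal (ℕₚ.+-comm e d) (ideal-mul ideal t h))
        (∈-scl (part ideal (d ℕ.+ e)) a (ideal-mul ideal (S-^ baseS d) k)))

    value-gen : ∀ k → Value 1 (q k) (coord k)
    value-gen k = S-gen k , ∈-rsp (part ideal 1) (λ v → +-congˡ (-‿cong (*-congˡ (sym (*-identityʳ (base v)))))) (cong k)

    value-exists : ∀ {d f} → S d f → ∃ (Value d f)
    value-exists one       = 1# , value-one
    value-exists zer       = 0# , value-zer
    value-exists (add s t) = _ , value-add (proj₂ (value-exists s)) (proj₂ (value-exists t))
    value-exists (scl b s) = _ , value-scl b (proj₂ (value-exists s))
    value-exists (gen k s) = _ , value-mul (value-gen k) (proj₂ (value-exists s))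
    value-exists (rsp e s) = _ , value-rsp e refl (proj₂ (value-exists s))

    -- Modulo `ideal` every form of degree d is a multiple of the d-th power of `base`; if that
    -- power lay in `ideal`, everything of degree d would.
    base-^-∉ : ∀ d → ¬ (ideal ∋ d) (λ v → base v ^ d)
    base-^-∉ d h = nv d λ f hf → let a , _ , k = value-exists hf in
      ∈-rsp (part ideal d) (λ v → solve 2 (λ f B → (f :- B) :+ B := f) refl (f v) (a * base v ^ d))
        (∈-add (part ideal d) k (∈-scl (part ideal d) a h))

    -- Relations hold at the point: if f lies in K, then `a * base v ^ d` lies in `ideal`, and a
    -- non-zero a could be divided out.
    value-∈ : ∀ {d f a} → Value d f a → (K ∋ d) f → ¬ ¬ a ≈ 0#
    value-∈ {d} {f} {a} (s , h) f∈K a≉0 = base-^-∉ d (∈-rsp (part ideal d)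
      (λ v → trans (solve 4 (λ f z a B → z :* (f :+ (:- con (+ 1)) :* (f :- a :* B)) := (z :* a) :* B) refl (f v) z a (base v ^ d))
                (trans (*-congʳ za≈1) (*-identityˡ _)))
      (∈-scl (part ideal d) z (∈-add (part ideal d) (K⊑ d f f∈K) (∈-scl (part ideal d) (- 1#) h))))
      where z    = proj₁ (divide a≉0 1#)
            za≈1 = proj₂ (divide a≉0 1#)

    -- If all coordinates vanished, `ideal` would contain all generators, and hence everything of
    -- degree 1.
    coord-nonzero : ¬ (∀ k → coord k ≈ 0#)
    coord-nonzero zero-coord = nv 1 λ f hf → all-in hf
      where
      all-in : ∀ {d f} → S (suc d) f → (ideal ∋ suc d) f
      all-in zer       = ∈-zer (part ideal _)
      all-in (add s t) = ∈-add (part ideal _) (all-in s) (all-in t)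
      all-in (scl b s) = ∈-scl (part ideal _) b (all-in s)
      all-in {d} (gen k {f} s) = ∈-rsp (part ideal (suc d)) (λ v → *-comm (f v) (q k v))
        (transport ideal (ℕₚ.+-comm d 1) (ideal-mul ideal s
          (∈-rsp (part ideal 1) (λ v → trans (+-congˡ (-‿cong (trans (*-congʳ (zero-coord k)) (zeroˡ _))))
             (solve 1 (λ f → f :- con (+ 0) := f) refl (q k v))) (cong k))))
      all-in (rsp e s) = ∈-rsp (part ideal _) e (all-in s)

-- Polynomial functions of one variable.

module MonicFunctions {c ℓ : Level} (F : Field c ℓ) where
  open Field F hiding (zero)
  open FieldSolver F
  open FieldLemmas F
  open BinaryForms F

  -- Polynomials of degree less than D in Horner form, as functions: only their values along a curve
  -- matter.
  Deg< : ℕ → (Carrier → Carrier) → Set (c ⊔ ℓ)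
  Deg< zero    g = ∀ t → g t ≈ 0#
  Deg< (suc D) g = ∃₂ λ b h → Deg< D h × (∀ t → g t ≈ t * h t + b)

  deg-rsp : ∀ D {f g} → (∀ t → f t ≈ g t) → Deg< D f → Deg< D g
  deg-rsp zero    e h             = λ t → trans (sym (e t)) (h t)
  deg-rsp (suc D) e (b , h , d , k) = b , h , d , λ t → trans (sym (e t)) (k t)

  deg-zero : ∀ D → Deg< D (λ _ → 0#)
  deg-zero zero    = λ _ → refl
  deg-zero (suc D) = 0# , (λ _ → 0#) , deg-zero D , λ t → solve 1 (λ t → con (+ 0) := t :* con (+ 0) :+ con (+ 0)) refl t

  deg-add : ∀ D {f g} → Deg< D f → Deg< D g → Deg< D (λ t → f t + g t)
  deg-add zero    h k = λ t → trans (+-cong (h t) (k t)) (+-identityˡ 0#)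
  deg-add (suc D) (b , f , d , e) (b′ , f′ , d′ , e′) = b + b′ , (λ t → f t + f′ t) , deg-add D d d′ , λ t →
    trans (+-cong (e t) (e′ t))
      (solve 5 (λ t f b f′ b′ → (t :* f :+ b) :+ (t :* f′ :+ b′) := t :* (f :+ f′) :+ (b :+ b′)) refl t (f t) b (f′ t) b′)

  deg-scl : ∀ D a {f} → Deg< D f → Deg< D (λ t → a * f t)
  deg-scl zero    a h = λ t → trans (*-congˡ (h t)) (zeroʳ a)
  deg-scl (suc D) a (b , f , d , e) = a * b , (λ t → a * f t) , deg-scl D a d , λ t →
    trans (*-congˡ (e t)) (solve 4 (λ a t f b → a :* (t :* f :+ b) := t :* (a :* f) :+ a :* b) refl a t (f t) b)

  deg-shift : ∀ D {f} → Deg< D f → Deg< (suc D) (λ t → t * f t)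
  deg-shift D {f} h = 0# , f , h , λ t → sym (+-identityʳ _)

  deg-suc : ∀ D {f} → Deg< D f → Deg< (suc D) f
  deg-suc zero    h = 0# , (λ _ → 0#) , (λ _ → refl) , λ t →
    trans (h t) (solve 1 (λ t → con (+ 0) := t :* con (+ 0) :+ con (+ 0)) refl t)
  deg-suc (suc D) (b , f , d , e) = b , f , deg-suc D d , e

  deg-+ : ∀ e {D f} → Deg< D f → Deg< (e ℕ.+ D) f
  deg-+ zero    h = h
  deg-+ (suc e) {D} h = deg-suc (e ℕ.+ D) (deg-+ e h)

  deg-≤ : ∀ {D E f} → D ℕ.≤ E → Deg< D f → Deg< E f
  deg-≤ {D} {E} {f} le h = ≡.subst (λ E → Deg< E f) (ℕₚ.m∸n+n≡m le) (deg-+ (E ℕ.∸ D) h)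

  deg-^ : ∀ D → Deg< (suc D) (λ t → t ^ D)
  deg-^ zero    = 1# , (λ _ → 0#) , (λ _ → refl) , λ t → solve 1 (λ t → con (+ 1) := t :* con (+ 0) :+ con (+ 1)) refl t
  deg-^ (suc D) = deg-shift (suc D) (deg-^ D)

  -- The degree of f is less than D and that of g at most E; this asymmetry makes D + E a strict
  -- bound without subtraction.
  deg-mul : ∀ D E {f g} → Deg< D f → Deg< (suc E) g → Deg< (D ℕ.+ E) (λ t → f t * g t)
  deg-mul zero E h k = deg-rsp E (λ t → sym (trans (*-congʳ (h t)) (zeroˡ _))) (deg-zero E)
  deg-mul (suc D) E {f} {g} (b , h , d , e) k = deg-rsp (suc (D ℕ.+ E))
    (λ t → sym (trans (*-congʳ (e t)) (solve 4 (λ t h b g → (t :* h :+ b) :* g := t :* (h :* g) :+ b :* g) refl t (h t) b (g t))))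
    (deg-add (suc (D ℕ.+ E)) (deg-shift (D ℕ.+ E) (deg-mul D E d k)) (deg-≤ (s≤s (ℕₚ.m≤n+m E D)) (deg-scl (suc E) b k)))

  Monic : ℕ → (Carrier → Carrier) → Set (c ⊔ ℓ)
  Monic D f = ∃ λ g → Deg< D g × (∀ t → f t ≈ t ^ D + g t)

  monic-degree : ∀ {D E f} → D ≡ E → Monic D f → Monic E f
  monic-degree ≡.refl h = h

  monic-rsp : ∀ {D f g} → (∀ t → f t ≈ g t) → Monic D f → Monic D g
  monic-rsp e (h , d , k) = h , d , λ t → trans (sym (e t)) (k t)

  monic-^ : ∀ D → Monic D (λ t → t ^ D)
  monic-^ D = (λ _ → 0#) , deg-zero D , λ t → sym (+-identityʳ _)

  monic-deg : ∀ D {f} → Monic D f → Deg< (suc D) f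
  monic-deg D (g , d , e) = deg-rsp (suc D) (λ t → sym (e t)) (deg-add (suc D) (deg-^ D) (deg-suc D d))

  monic-add : ∀ D {f g} → Monic D f → Deg< D g → Monic D (λ t → f t + g t)
  monic-add D {f} {g} (h , d , e) k = (λ t → h t + g t) , deg-add D d k , λ t → trans (+-congʳ (e t)) (+-assoc _ _ _)

  monic-mul : ∀ D E {f g} → Monic D f → Monic E g → Monic (D ℕ.+ E) (λ t → f t * g t)
  monic-mul D E {f} {g} (h , d , e) k@(h′ , d′ , e′) = monic-rsp
    (λ t → sym (trans (*-congʳ (e t)) (trans (distribʳ _ _ _) (+-congʳ (trans (*-congˡ (e′ t)) (distribˡ _ _ _))))))
    (monic-add (D ℕ.+ E) {λ t → t ^ D * t ^ E + t ^ D * h′ t} {λ t → h t * g t}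
      (monic-add (D ℕ.+ E) {λ t → t ^ D * t ^ E} {λ t → t ^ D * h′ t}
        (monic-rsp (λ t → ^-+ t D E) (monic-^ (D ℕ.+ E)))
        (deg-rsp (D ℕ.+ E) (λ t → *-comm _ _) (≡.subst (λ N → Deg< N (λ t → h′ t * t ^ D)) (ℕₚ.+-comm E D) (deg-mul E D d′ (deg-^ D)))))
      (deg-mul D E d (monic-deg E k)))

  monic-pow : ∀ D {f} m → Monic D f → Monic (m ℕ.* D) (λ t → f t ^ m)
  monic-pow D zero    h = monic-^ 0
  monic-pow D (suc m) h = monic-mul D (m ℕ.* D) h (monic-pow D m h)

  deg-coefficients : ∀ D {g} → Deg< D g → ∃ λ cs → ∀ t → g t ≈ Σ[<_] F D (λ i → cs i * t ^ toℕ i)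
  deg-coefficients zero h = (λ ()) , h
  deg-coefficients (suc D) (b , h , d , e) with deg-coefficients D d
  ... | cs , eq = (λ { zero → b ; (suc i) → cs i }) , λ t →
    trans (e t) (trans (+-congʳ (trans (*-congˡ (eq t)) (sym (Σ-scale D t cs (λ i → t ^ toℕ i)))))
      (trans (+-comm _ _) (+-congʳ (sym (*-identityʳ b)))))

  -- A monic f of positive degree takes the value 1, because f − 1 has a root.
  monic-nonzero : AlgClosed F → ∀ D {f} → Monic D f → ¬ (∀ t → ¬ ¬ f t ≈ 0#)
  monic-nonzero closed zero (g , d , e) h = h 0# λ z →
    1≉0 (trans (sym (trans (+-congˡ (d 0#)) (+-identityʳ 1#))) (trans (sym (e 0#)) z))
  monic-nonzero closed (suc D) {f} (g , d , e) h = h t λ z → 1≉0 (trans f≈1 z)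
    where
    shifted : Deg< (suc D) (λ t → g t + - 1# * 1#)
    shifted = deg-add (suc D) {g} {λ t → - 1# * 1#} d
      (deg-scl (suc D) (- 1#) {λ t → 1#} (deg-≤ {1} {suc D} {λ t → 1#} (s≤s z≤n) (deg-^ 0)))
    cs : Fin (suc D) → Carrier
    cs = proj₁ (deg-coefficients (suc D) shifted)
    t : Carrier
    t = proj₁ (closed D cs)
    isRoot : t ^ suc D + (g t + - 1# * 1#) ≈ 0#
    isRoot = trans (+-congˡ (proj₂ (deg-coefficients (suc D) shifted) t)) (proj₂ (closed D cs))
    algebra : ∀ T y → T + (y + - 1# * 1#) ≈ 0# → 1# ≈ T + y
    algebra T y z = sym (difference-zero
      (trans (solve 2 (λ T y → (T :+ y) :- con (+ 1) := T :+ (y :+ (:- con (+ 1)) :* con (+ 1))) refl T y) z))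
    f≈1 : 1# ≈ f t
    f≈1 = trans (algebra (t ^ suc D) (g t) isRoot) (sym (e t))

-- Symmetric matrices of bounded rank, and a curve of such matrices.

-- Dimension of the variety of symmetric n × n matrices of rank at most r: the number of entries on or
-- above the diagonal in the first r rows.
dim : ℕ → ℕ → ℕ
dim (suc r) (suc n) = suc n ℕ.+ dim r n
dim _       _       = 0

-- The numbering proceeds row by row, so an entry of a later row has a larger index, and hence a
-- larger weight, than all entries of earlier rows.
freeEntry : ∀ r n → Fin (dim r n) → Fin n × Fin n
freeEntry (suc r) (suc n) k =
  [ (λ j → zero , j) , (λ k′ → let i , j = freeEntry r n k′ in suc i , suc j) ]′ (splitAt (suc n) k)

-- Symmetric n × n matrices of rank at most r, in the form L D Lᵀ.
module LDL {c ℓ : Level} (F : Field c ℓ) where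
  open Field F hiding (zero)
  open FieldSolver F
  open BinaryForms F
  open MonicFunctions F

  -- The pivot, the column of L below the diagonal, and the parameters of the Schur complement.
  Params : ℕ → ℕ → Set c
  Params (suc r) (suc n) = Carrier × (Fin n → Carrier) × Params r n
  Params _       _       = Lift c ⊤

  entry : ∀ r n → Params r n → Fin n → Fin n → Carrier
  entry zero    n       _           i       j       = 0#
  entry (suc r) (suc n) (a , u , v) zero    zero    = a
  entry (suc r) (suc n) (a , u , v) zero    (suc j) = a * u j
  entry (suc r) (suc n) (a , u , v) (suc i) zero    = a * u i
  entry (suc r) (suc n) (a , u , v) (suc i) (suc j) = a * (u i * u j) + entry r n v i j

  entry-sym : ∀ r n v i j → entry r n v i j ≈ entry r n v j i
  entry-sym zero    n       v           i       j       = refl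
  entry-sym (suc r) (suc n) (a , u , v) zero    zero    = refl
  entry-sym (suc r) (suc n) (a , u , v) zero    (suc j) = refl
  entry-sym (suc r) (suc n) (a , u , v) (suc i) zero    = refl
  entry-sym (suc r) (suc n) (a , u , v) (suc i) (suc j) = +-cong (*-congˡ (*-comm _ _)) (entry-sym r n v i j)

  module Curve (ω : ℕ → ℕ) (superincreasing : ∀ {x y z} → x ℕ.< z → y ℕ.< z → ω x ℕ.+ ω y ℕ.< ω z) where

    ω-mono : ∀ {x y} → x ℕ.≤ y → ω x ℕ.≤ ω y
    ω-mono {x} {y} le = [ (λ lt → ℕₚ.<⇒≤ (ℕₚ.≤-<-trans (ℕₚ.m≤m+n (ω x) (ω x)) (superincreasing lt lt)))
                        , (λ { ≡.refl → ℕₚ.≤-refl }) ]′ (ℕₚ.m≤n⇒m<n∨m≡n le)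

    -- The exponents are chosen so that the first row of the matrix becomes t^(ω s), t^(ω (s+1)),
    -- and so on. The offset s counts the free entries in the preceding rows.
    curve : ∀ r n → ℕ → Carrier → Params r n
    curve zero    n       s t = lift tt
    curve (suc r) zero    s t = lift tt
    curve (suc r) (suc n) s t = t ^ ω s , (λ j → t ^ (ω (s ℕ.+ suc (toℕ j)) ℕ.∸ ω s)) , curve r n (s ℕ.+ suc n) t

    private
      ω-split : ∀ s j → ω s ℕ.+ (ω (s ℕ.+ j) ℕ.∸ ω s) ≡ ω (s ℕ.+ j)
      ω-split s j = ℕₚ.m+[n∸m]≡n (ω-mono (ℕₚ.m≤m+n s j))

    module _ (r n s : ℕ) where
      private
        row : Fin n → Carrier → Carrier
        row j t = t ^ (ω (s ℕ.+ suc (toℕ j)) ℕ.∸ ω s)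

      first-row-monic : ∀ j → Monic (ω (s ℕ.+ toℕ j)) (λ t → entry (suc r) (suc n) (curve (suc r) (suc n) s t) zero j)
      first-row-monic zero    = monic-degree (≡.cong ω (≡.sym (ℕₚ.+-identityʳ s))) (monic-^ (ω s))
      first-row-monic (suc j) = monic-degree (ω-split s (suc (toℕ j)))
        (monic-mul (ω s) _ (monic-^ (ω s)) (monic-^ _))

      -- What the first row adds to later entries has degree at most the sum of two weights of that
      -- row, which a superincreasing ω keeps below any later weight.
      first-row-small : ∀ i j z → s ℕ.+ n ℕ.< z → Deg< (ω z) (λ t → t ^ ω s * (row i t * row j t))
      first-row-small i j z lt = deg-rsp (ω z)
        (λ t → trans (^-+ t (ω s) _) (*-congˡ (^-+ t (ω (s ℕ.+ suc (toℕ i)) ℕ.∸ ω s) _)))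
        (deg-≤ (begin-strict
          ω s ℕ.+ (ω (s ℕ.+ suc (toℕ i)) ℕ.∸ ω s ℕ.+ (ω (s ℕ.+ suc (toℕ j)) ℕ.∸ ω s))
            ≡⟨ ℕₚ.+-assoc (ω s) _ _ ⟨
          ω s ℕ.+ (ω (s ℕ.+ suc (toℕ i)) ℕ.∸ ω s) ℕ.+ (ω (s ℕ.+ suc (toℕ j)) ℕ.∸ ω s)
            ≡⟨ ≡.cong (ℕ._+ (ω (s ℕ.+ suc (toℕ j)) ℕ.∸ ω s)) (ω-split s (suc (toℕ i))) ⟩
          ω (s ℕ.+ suc (toℕ i)) ℕ.+ (ω (s ℕ.+ suc (toℕ j)) ℕ.∸ ω s)
            ≤⟨ ℕₚ.+-monoʳ-≤ _ (ℕₚ.m∸n≤m _ (ω s)) ⟩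
          ω (s ℕ.+ suc (toℕ i)) ℕ.+ ω (s ℕ.+ suc (toℕ j))
            <⟨ superincreasing (below i) (below j) ⟩
          ω z ∎) (deg-^ _))
        where
        open ℕₚ.≤-Reasoning
        below : ∀ (i : Fin n) → s ℕ.+ suc (toℕ i) ℕ.< z
        below i = ℕₚ.≤-<-trans (ℕₚ.+-monoʳ-≤ s (toℕ<n i)) lt

    -- Below the first row, an entry is that of the Schur complement plus a term of smaller degree,
    -- so the leading power of t survives.
    freeEntry-monic : ∀ r n s k → Monic (ω (s ℕ.+ toℕ k))
      (λ t → entry r n (curve r n s t) (proj₁ (freeEntry r n k)) (proj₂ (freeEntry r n k)))
    freeEntry-monic (suc r) (suc n) s k with splitAt (suc n) k | join-splitAt (suc n) (dim r n) k
    ... | inj₁ j  | ≡.refl = monic-degree (≡.cong (λ x → ω (s ℕ.+ x)) (≡.sym (toℕ-↑ˡ j (dim r n)))) (first-row-monic r n s j)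
    ... | inj₂ k′ | ≡.refl = monic-degree (≡.cong ω index)
        (monic-rsp (λ t → +-comm _ _)
          (monic-add (ω z) (freeEntry-monic r n (s ℕ.+ suc n) k′)
            (first-row-small r n s (proj₁ (freeEntry r n k′)) (proj₂ (freeEntry r n k′)) z
              (≡.subst (ℕ._≤ z) (ℕₚ.+-suc s n) (ℕₚ.m≤m+n (s ℕ.+ suc n) (toℕ k′))))))
      where
      z = s ℕ.+ suc n ℕ.+ toℕ k′
      index : z ≡ s ℕ.+ toℕ (suc n ↑ʳ k′)
      index = ≡.trans (ℕₚ.+-assoc s (suc n) (toℕ k′)) (≡.cong (s ℕ.+_) (≡.sym (toℕ-↑ʳ (suc n) k′)))

-- Superincreasing weights and the comparison of growth rates.

module Weights where
  open import Data.Nat using (_+_; _*_; _^_; _≤_; _<_)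
  open ℕₚ.≤-Reasoning

  -- Weight 0 makes the first free entry constant along the curve, so that it can serve to
  -- homogenise; the others are the place values in base B.
  weight : ℕ → ℕ → ℕ
  weight B zero    = 0
  weight B (suc k) = B ^ k

  -- As B ≥ 3, each of the two smaller weights is at most a third of the larger one.
  weight-superincreasing : ∀ B → 3 ≤ B → ∀ {x y z} → x < z → y < z → weight B x + weight B y < weight B z
  weight-superincreasing B@(suc _) 3≤B {x} {y} {suc z} x<z y<z = ℕₚ.*-cancelˡ-< 3 _ _ (begin-strict
    3 * (weight B x + weight B y)         ≡⟨ ℕₚ.*-distribˡ-+ 3 (weight B x) (weight B y) ⟩
    3 * weight B x + 3 * weight B y       ≤⟨ ℕₚ.+-mono-≤ (third x (ℕₚ.≤-pred x<z)) (third y (ℕₚ.≤-pred y<z)) ⟩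
    B ^ z + B ^ z                         <⟨ ℕₚ.+-monoʳ-< (B ^ z) (ℕₚ.m<m+n (B ^ z) (ℕₚ.≤-trans (ℕₚ.m^n>0 B z) (ℕₚ.m≤m+n (B ^ z) 0))) ⟩
    3 * B ^ z ∎)
    where
    third : ∀ x → x ≤ z → 3 * weight B x ≤ B ^ z
    third zero    _   = z≤n
    third (suc x) x<z = ℕₚ.≤-trans (ℕₚ.*-monoˡ-≤ (B ^ x) 3≤B) (ℕₚ.^-monoʳ-≤ B x<z)

  *-^ : ∀ a b j → (a * b) ^ j ≡ a ^ j * b ^ j
  *-^ a b zero    = ≡.refl
  *-^ a b (suc j) = ≡.trans (≡.cong (a * b *_) (*-^ a b j))
    (solve 4 (λ a b x y → a :* b :* (x :* y) := a :* x :* (b :* y)) ≡.refl a b (a ^ j) (b ^ j))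
    where open Data.Nat.Solver.+-*-Solver using (solve; _:=_; _:*_)

  -- Since mE + 1 ≤ m(E + 1) and j ≤ m - 1, the power (E + 1)^(m-1) cancels. The result fails for
  -- large E, so growth of order m is incompatible with growth of order j.
  exponent-bound : ∀ {C m j} E → j < m → (suc E) ^ m ≤ C * suc (m * E) ^ j → suc E ≤ C * m ^ j
  exponent-bound {C} {suc m} {j} E (s≤s j≤m) h = ℕₚ.*-cancelʳ-≤ (suc E) (C * suc m ^ j) (suc E ^ m) {{ℕₚ.m^n≢0 (suc E) m}} (begin
    suc E ^ suc m                          ≤⟨ h ⟩
    C * suc (suc m * E) ^ j                ≤⟨ ℕₚ.*-monoʳ-≤ C (ℕₚ.^-monoˡ-≤ j base) ⟩
    C * (suc m * suc E) ^ j                ≡⟨ ≡.cong (C *_) (*-^ (suc m) (suc E) j) ⟩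
    C * (suc m ^ j * suc E ^ j)            ≡⟨ ℕₚ.*-assoc C (suc m ^ j) (suc E ^ j) ⟨
    C * suc m ^ j * suc E ^ j              ≤⟨ ℕₚ.*-monoʳ-≤ (C * suc m ^ j) (ℕₚ.^-monoʳ-≤ (suc E) j≤m) ⟩
    C * suc m ^ j * suc E ^ m ∎)
    where
    base : suc (suc m * E) ≤ suc m * suc E
    base = begin
      suc (suc m * E)      ≤⟨ s≤s (ℕₚ.m≤n+m (suc m * E) m) ⟩
      suc m + suc m * E    ≡⟨ ℕₚ.*-suc (suc m) E ⟨
      suc m * suc E        ∎

-- The coordinate ring of the rank variety and its linear sections.

module RankVariety {c ℓ : Level} (F : Field c ℓ) (closed : AlgClosed F) (r n : ℕ) where
  open Field F hiding (zero)
  open FieldSolver F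
  open FieldLemmas F
  open BinaryForms F
  open MonicFunctions F
  open LDL F
  open Weights

  V : Set c
  V = Params r n

  generator : Fin n × Fin n → V → Carrier
  generator (i , j) v = entry r n v i j

  allPairs : List (Fin n × Fin n)
  allPairs = cartesianProduct (allFin n) (allFin n)

  ∈-allPairs : ∀ k → k ∈ allPairs
  ∈-allPairs (i , j) = ∈-cartesianProduct⁺ (∈-allFin i) (∈-allFin j)

  open LinearAlgebra F V
  open GradedAlgebra F closed allPairs ∈-allPairs generator public
  open Subspace
  open Ideal

  -- The zero ideal up to double negation. Identities between matrix entries that hold on V belong
  -- to it, and through `value-∈` they hold at every point.
  relations : Ideal
  relations = record
    { part = λ _ → record
      { mem = λ f → ∀ v → ¬ ¬ f v ≈ 0#
      ; ∈-rsp = λ e h v → h v >>= λ z → return (trans (sym (e v)) z)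
      ; ∈-zer = λ v → return refl
      ; ∈-add = λ h k v → h v >>= λ z → k v >>= λ z′ → return (trans (+-cong z z′) (+-identityˡ 0#))
      ; ∈-scl = λ b h v → h v >>= λ z → return (trans (*-congˡ z) (zeroʳ b)) }
    ; gen-∈ = λ k h v → h v >>= λ z → return (trans (*-congˡ z) (zeroʳ (generator k v))) }

  module _ (γ : Carrier → V) where

    infix 4 _along
    _along : Fn → Carrier → Carrier
    (f along) t = f (γ t)

    Decreasing : ℕ → List Fn → Set (c ⊔ ℓ)
    Decreasing D []       = Lift _ ⊤
    Decreasing D (f ∷ fs) = ∃ λ D′ → D′ ℕ.< D × Monic D′ (f along) × Decreasing D′ fs

    decreasing-weaken : ∀ {D E} → D ℕ.≤ E → ∀ fs → Decreasing D fs → Decreasing E fs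
    decreasing-weaken le []       h                  = h
    decreasing-weaken le (f ∷ fs) (D′ , lt , m , h) = D′ , ℕₚ.<-≤-trans lt le , m , h

    -- The members with the factor h have degrees from a up to below a + D, and those of gs have
    -- degrees below a.
    decreasing-block : ∀ {a D h gs} → Monic a (h along) → ∀ fs → Decreasing D fs → Decreasing a gs →
      Decreasing (a ℕ.+ D) (map (h ·_) fs ++ gs)
    decreasing-block {a} {D} {h} {gs} mh [] _ dg = decreasing-weaken (ℕₚ.m≤m+n a D) gs dg
    decreasing-block {a} {D} {h} {gs} mh (f ∷ fs) (D′ , lt , m , df) dg =
      a ℕ.+ D′ , ℕₚ.+-monoʳ-< a lt , monic-mul a D′ mh m , decreasing-block mh fs df dg

    decreasing-LC : ∀ {d D f} fs → Decreasing D fs → LC (part relations d) fs f →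
      ∃ λ g → Deg< D g × (∀ t → ¬ ¬ f (γ t) ≈ g t)
    decreasing-LC {D = D} [] _ h = (λ _ → 0#) , deg-zero D , λ t → h (γ t)
    decreasing-LC {d} {D} {f} (g₁ ∷ fs) (D′ , lt , m , df) (b , h) with decreasing-LC {d} {D′} fs df h
    ... | g , dg , k = (λ t → g t + b * g₁ (γ t)) ,
      deg-add D (deg-≤ (ℕₚ.<⇒≤ lt) dg) (deg-≤ lt (deg-scl (suc D′) b (monic-deg D′ m))) ,
      λ t → k t >>= λ e → return (trans
        (solve 3 (λ f b g → f := (f :- b :* g) :+ b :* g) refl (f (γ t)) b (g₁ (γ t))) (+-congʳ e))

    -- A member minus a combination of later ones is monic along the curve, so it cannot vanish
    -- everywhere.
    decreasing-independent : ∀ {d D} fs → Decreasing D fs → ¬ Dep (part relations d) fs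
    decreasing-independent {d} (f ∷ fs) (D′ , lt , m , df) (inj₂ dep) = decreasing-independent {d} fs df dep
    decreasing-independent {d} (f ∷ fs) (D′ , lt , m , df) (inj₁ h) with decreasing-LC {d} {D′} {f} fs df h
    ... | g , dg , k = monic-nonzero closed D′ (monic-add D′ m (deg-scl D′ (- 1#) dg)) λ t →
      k t >>= λ e → return (trans (+-congʳ e) (solve 1 (λ g → g :+ (:- con (+ 1)) :* g := con (+ 0)) refl (g t)))

    module Monomials (E : ℕ) (y₀ : Fn) (y₀∈S : S 1 y₀) (y₀-monic : Monic 0 (y₀ along)) where

      private
        -- The power y^e made homogeneous of degree E by y₀, which has degree 0 along the curve and
        -- leaves the degree in t unchanged.
        factor : Fn → ℕ → Fn
        factor y e v = y v ^ e * y₀ v ^ (E ℕ.∸ e)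

        factor-S : ∀ {y} e → e ℕ.≤ E → S 1 y → S E (factor y e)
        factor-S {y} e le hy = ≡.subst (λ D → S D (factor y e)) (ℕₚ.m+[n∸m]≡n le)
          (S-mul (S-^ hy e) (S-^ y₀∈S (E ℕ.∸ e)))

        factor-monic : ∀ {y D} e → Monic D (y along) → Monic (e ℕ.* D) (factor y e along)
        factor-monic {y} {D} e m = monic-degree
          (≡.trans (≡.cong (e ℕ.* D ℕ.+_) (ℕₚ.*-zeroʳ (E ℕ.∸ e))) (ℕₚ.+-identityʳ _))
          (monic-mul (e ℕ.* D) ((E ℕ.∸ e) ℕ.* 0) (monic-pow D e m) (monic-pow 0 (E ℕ.∸ e) y₀-monic))

        blocks : Fn → List Fn → ℕ → List Fn
        blocks y fs zero    = []
        blocks y fs (suc e) = map (factor y e ·_) fs ++ blocks y fs e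

        blocks-length : ∀ y fs e → length (blocks y fs e) ≡ e ℕ.* length fs
        blocks-length y fs zero    = ≡.refl
        blocks-length y fs (suc e) = ≡.trans (length-++ (map (factor y e ·_) fs))
          (≡.cong₂ ℕ._+_ (length-map _ fs) (blocks-length y fs e))

        blocks-S : ∀ {y D} → S 1 y → ∀ fs → All (S D) fs → ∀ e → e ℕ.≤ suc E → All (S (E ℕ.+ D)) (blocks y fs e)
        blocks-S hy fs hfs zero    le = []
        blocks-S {y} {D} hy fs hfs (suc e) (s≤s le) = Allₚ.++⁺ (go hfs) (blocks-S hy fs hfs e (ℕₚ.≤-trans le (ℕₚ.n≤1+n E)))
          where
          go : ∀ {fs} → All (S D) fs → All (S (E ℕ.+ D)) (map (factor y e ·_) fs)
          go []       = []
          go (h ∷ hs) = S-mul (factor-S e le hy) h ∷ go hs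

        blocks-decreasing : ∀ {y D} → Monic D (y along) → ∀ fs → Decreasing D fs → ∀ e → Decreasing (e ℕ.* D) (blocks y fs e)
        blocks-decreasing m fs dfs zero    = _
        blocks-decreasing {y} {D} m fs dfs (suc e) = decreasing-weaken (ℕₚ.≤-reflexive (ℕₚ.+-comm (e ℕ.* D) D))
          (map (factor y e ·_) fs ++ blocks y fs e)
          (decreasing-block (factor-monic {y} e m) fs dfs (blocks-decreasing m fs dfs e))

      -- All monomials of degree mE in y₀, …, yₘ in which y₁, …, yₘ have exponents at most E.
      monomials : ∀ m → (Fin m → Fn) → List Fn
      monomials zero    y = (λ _ → 1#) ∷ []
      monomials (suc m) y = blocks (y (fromℕ m)) (monomials m (λ i → y (inject₁ i))) (suc E)

      monomials-length : ∀ m y → length (monomials m y) ≡ suc E ℕ.^ m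
      monomials-length zero    y = ≡.refl
      monomials-length (suc m) y = ≡.trans (blocks-length (y (fromℕ m)) (monomials m (λ i → y (inject₁ i))) (suc E))
        (≡.cong (suc E ℕ.*_) (monomials-length m (λ i → y (inject₁ i))))

      monomials-S : ∀ m y → (∀ i → S 1 (y i)) → All (S (m ℕ.* E)) (monomials m y)
      monomials-S zero    y hy = one ∷ []
      monomials-S (suc m) y hy = blocks-S (hy (fromℕ m)) (monomials m (λ i → y (inject₁ i)))
        (monomials-S m (λ i → y (inject₁ i)) (λ i → hy (inject₁ i))) (suc E) ℕₚ.≤-refl

      -- The exponents of y₁, ..., yₘ are the digits in base E + 1 of the degree along the curve, so
      -- distinct monomials have distinct degrees below (E + 1)^m.
      monomials-decreasing : ∀ m y → (∀ i → Monic (suc E ℕ.^ toℕ i) (y i along)) → Decreasing (suc E ℕ.^ m) (monomials m y)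
      monomials-decreasing zero    y hy = 0 , s≤s z≤n , monic-^ 0 , _
      monomials-decreasing (suc m) y hy = blocks-decreasing
        (monic-degree (≡.cong (suc E ℕ.^_) (toℕ-fromℕ m)) (hy (fromℕ m))) (monomials m (λ i → y (inject₁ i)))
        (monomials-decreasing m (λ i → y (inject₁ i)) (λ i → monic-degree (≡.cong (suc E ℕ.^_) (toℕ-inject₁ i)) (hy (inject₁ i))))
        (suc E)

  module _ {m : ℕ} (dim≡ : dim r n ≡ suc m) where

    private
      variables : Fin (suc m) → Fn
      variables k = generator (freeEntry r n (≡.subst Fin (≡.sym dim≡) k))

      variables-S : ∀ k → S 1 (variables k)
      variables-S k = S-gen _

      module AlongCurve (E : ℕ) (2≤E : 2 ℕ.≤ E) where
        private
          superincreasing : ∀ {x y z} → x ℕ.< z → y ℕ.< z → weight (suc E) x ℕ.+ weight (suc E) y ℕ.< weight (suc E) z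
          superincreasing = weight-superincreasing (suc E) (s≤s 2≤E)

        open Curve (weight (suc E)) superincreasing

        γ : Carrier → V
        γ = curve r n 0

        variables-monic : ∀ k → Monic (weight (suc E) (toℕ k)) (λ t → variables k (γ t))
        variables-monic k = monic-degree (≡.cong (weight (suc E)) (toℕ-subst (≡.sym dim≡) k))
          (freeEntry-monic r n 0 (≡.subst Fin (≡.sym dim≡) k))
          where
          toℕ-subst : ∀ {a b} (e : a ≡ b) (k : Fin a) → toℕ (≡.subst Fin e k) ≡ toℕ k
          toℕ-subst ≡.refl k = ≡.refl

        open Monomials γ E (variables zero) (variables-S zero) (variables-monic zero) public

    hilbert-lower : ∀ E → 2 ℕ.≤ E → ∀ {k} → HilbertLe relations (m ℕ.* E) k → suc E ℕ.^ m ℕ.≤ k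
    hilbert-lower E 2≤E {k} (gs , len , sp) = decidable-stable (_ ℕ.≤? _) λ k≱ →
      steinitz (part relations (m ℕ.* E)) gs fs (All.map (λ {f} → sp f) (monomials-S m y (λ i → variables-S (suc i))))
        (≡.subst (length gs ℕ.<_) (≡.sym (monomials-length m y)) (ℕₚ.≤-<-trans len (ℕₚ.≰⇒> k≱)))
        (decreasing-independent γ {m ℕ.* E} fs (monomials-decreasing m y (λ i → variables-monic (suc i))))
      where
      open AlongCurve E 2≤E
      y : Fin m → Fn
      y i = variables (suc i)
      fs = monomials m y

    -- The first free entry is monic of degree 0 along the curve, so none of its powers vanishes on
    -- V.
    relations-nonVanishing : NonVanishing relations
    relations-nonVanishing d van = monic-nonzero closed (d ℕ.* 0) (monic-pow 0 d (variables-monic zero))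
      λ t → van _ (S-^ (variables-S zero) d) (γ t)
      where open AlongCurve 2 ℕₚ.≤-refl

    section-nonVanishing : ∀ ls → All (S 1) ls → length ls ℕ.≤ m → ¬ ¬ NonVanishing (relations ⊕* ls)
    section-nonVanishing [] _ _ = return relations-nonVanishing
    section-nonVanishing (l ∷ ls) (hl ∷ hls) len = λ no → vanishing-degree (relations ⊕* (l ∷ ls)) no λ { (d₀ , van) →
      let C , h = hilbert-growth relations l ls hl hls d₀ van
          -- By `exponent-bound`, E + 1 is at most the second summand, which is absurd; the summand
          -- 2 meets the requirement of the weights.
          E     = 2 ℕ.+ C ℕ.* m ℕ.^ length ls
      in ℕₚ.1+n≰n (ℕₚ.≤-trans (ℕₚ.m≤n+m _ 2)
           (exponent-bound {C} E len (hilbert-lower E (ℕₚ.m≤m+n 2 _) (h (m ℕ.* E))))) }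

-- Finite sums and bilinear forms.

module Sums {c ℓ : Level} (F : Field c ℓ) where
  open Field F hiding (zero)
  open FieldSolver F

  ∑ : ∀ n → (Fin n → Carrier) → Carrier
  ∑ n = Σ[<_] F n

  ∑-cong : ∀ n {f g : Fin n → Carrier} → (∀ i → f i ≈ g i) → ∑ n f ≈ ∑ n g
  ∑-cong zero    e = refl
  ∑-cong (suc n) e = +-cong (e zero) (∑-cong n (λ i → e (suc i)))

  ∑-zero : ∀ n → ∑ n (λ _ → 0#) ≈ 0#
  ∑-zero zero    = refl
  ∑-zero (suc n) = trans (+-congˡ (∑-zero n)) (+-identityˡ 0#)

  ∑-add : ∀ n (f g : Fin n → Carrier) → ∑ n (λ i → f i + g i) ≈ ∑ n f + ∑ n g
  ∑-add zero    f g = sym (+-identityˡ 0#)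
  ∑-add (suc n) f g = trans (+-congˡ (∑-add n (λ i → f (suc i)) (λ i → g (suc i))))
    (solve 4 (λ a b x y → (a :+ b) :+ (x :+ y) := (a :+ x) :+ (b :+ y)) refl (f zero) (g zero) _ _)

  ∑-scl : ∀ n a (f : Fin n → Carrier) → ∑ n (λ i → a * f i) ≈ a * ∑ n f
  ∑-scl zero    a f = sym (zeroʳ a)
  ∑-scl (suc n) a f = trans (+-congˡ (∑-scl n a (λ i → f (suc i)))) (sym (distribˡ a _ _))

  ∑-swap : ∀ m n (f : Fin m → Fin n → Carrier) → ∑ m (λ i → ∑ n (f i)) ≈ ∑ n (λ j → ∑ m (λ i → f i j))
  ∑-swap zero    n f = sym (∑-zero n)
  ∑-swap (suc m) n f = trans (+-congˡ (∑-swap m n (λ i → f (suc i)))) (sym (∑-add n (f zero) _))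

  dot : ∀ {n} → (Fin n → Carrier) → (Fin n → Carrier) → Carrier
  dot {n} x f = ∑ n (λ i → x i * f i)

  dot-zero : ∀ {n} x {f : Fin n → Carrier} → (∀ i → f i ≈ 0#) → dot x f ≈ 0#
  dot-zero {n} x z = trans (∑-cong n (λ i → trans (*-congˡ (z i)) (zeroʳ (x i)))) (∑-zero n)

  dot-sub : ∀ {n} x (f : Fin n → Carrier) b g → dot x (λ i → f i - b * g i) ≈ dot x f - b * dot x g
  dot-sub {zero}  x f b g = solve 1 (λ b → con (+ 0) := con (+ 0) :- b :* con (+ 0)) refl b
  dot-sub {suc n} x f b g = trans (+-congˡ (dot-sub (λ i → x (suc i)) (λ i → f (suc i)) b (λ i → g (suc i))))
    (solve 6 (λ x f b g p q → x :* (f :- b :* g) :+ (p :- b :* q) := (x :* f :+ p) :- b :* (x :* g :+ q))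
      refl (x zero) (f zero) b (g zero) _ _)

  dot-addˡ : ∀ {n} x y (f : Fin n → Carrier) → dot (λ i → x i + y i) f ≈ dot x f + dot y f
  dot-addˡ {n} x y f = trans (∑-cong n (λ i → distribʳ (f i) (x i) (y i))) (∑-add n _ _)

  dot-addʳ : ∀ {n} x (f g : Fin n → Carrier) → dot x (λ i → f i + g i) ≈ dot x f + dot x g
  dot-addʳ {n} x f g = trans (∑-cong n (λ i → distribˡ (x i) (f i) (g i))) (∑-add n _ _)

  basis : ∀ {n} → Fin n → Fin n → Carrier
  basis zero    zero    = 1#
  basis zero    (suc j) = 0#
  basis (suc i) zero    = 0#
  basis (suc i) (suc j) = basis i j

  dot-basis : ∀ {n} i (f : Fin n → Carrier) → dot (basis i) f ≈ f i
  dot-basis {suc n} zero f = trans (+-cong (*-identityˡ _) (trans (∑-cong n (λ i → zeroˡ (f (suc i)))) (∑-zero n))) (+-identityʳ _)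
  dot-basis {suc n} (suc i) f = trans (+-cong (zeroˡ _) (dot-basis i (λ j → f (suc j)))) (+-identityˡ _)

  bilinear : ∀ {n} → (Fin n → Fin n → Carrier) → (Fin n → Carrier) → (Fin n → Carrier) → Carrier
  bilinear A x y = dot y (λ j → dot x (λ i → A i j))

  bilinear-basis : ∀ {n} (A : Fin n → Fin n → Carrier) i j → bilinear A (basis i) (basis j) ≈ A i j
  bilinear-basis A i j = trans (dot-basis j _) (dot-basis i _)

  bilinear-addˡ : ∀ {n} (A : Fin n → Fin n → Carrier) x y z →
    bilinear A (λ i → x i + y i) z ≈ bilinear A x z + bilinear A y z
  bilinear-addˡ {n} A x y z = trans (∑-cong n (λ j → *-congˡ (dot-addˡ x y (λ i → A i j)))) (dot-addʳ z _ _)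

  bilinear-sym : ∀ {n} (A : Fin n → Fin n → Carrier) → (∀ i j → A i j ≈ A j i) → ∀ x y → bilinear A x y ≈ bilinear A y x
  bilinear-sym {n} A A-sym x y = trans (∑-cong n (λ j → sym (∑-scl n (y j) _)))
    (trans (∑-swap n n _) (∑-cong n (λ i → trans (∑-cong n (λ j →
      trans (solve 3 (λ x y a → y :* (x :* a) := x :* (y :* a)) refl (x i) (y j) (A i j))
        (*-congˡ (*-congˡ (A-sym i j))))) (∑-scl n (x i) _))))

-- Rank and successive Schur complements.

module Reduction {c ℓ : Level} (F : Field c ℓ) (X : Set c) where
  open Field F hiding (zero)
  open FieldSolver F
  open FieldLemmas F
  open LinearAlgebra F X

  Form : Set c
  Form = X → X → Carrier

  -- Up to the scalar M u u, the Schur complement of M at u.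
  reduce : X → Form → Form
  reduce u M x y = M u u * M x y - M x u * M u y

  -- Rank at most r as a system of identities between values of M. As `reduce` does not divide, they
  -- are polynomial and can be carried over to a point.
  Kills : ℕ → Form → Set (c ⊔ ℓ)
  Kills zero    M = ∀ x y → ¬ ¬ M x y ≈ 0#
  Kills (suc r) M = ∀ u → Kills r (reduce u M)

  kills-stable : ∀ r M → ¬ ¬ Kills r M → Kills r M
  kills-stable zero    M h x y = h >>= λ k → k x y
  kills-stable (suc r) M h u   = kills-stable r (reduce u M) (h >>= λ k → return (k u))

  RankLe : ℕ → Form → Set (c ⊔ ℓ)
  RankLe r M = ∃ λ fs → length fs ℕ.≤ r × (∀ y → LC zeroSubspace fs (λ x → M x y))

  private
    evaluation : X → Functional
    evaluation u = record { apply = λ f → f u ; sub = λ f b g → refl }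

  -- All columns of reduce u M lie in the column space of M and vanish at u.
  rank-reduce : ∀ {r M} u → RankLe (suc r) M → ¬ ¬ RankLe r (reduce u M)
  rank-reduce {r} {M} u (fs , len , h) = split zeroSubspace (evaluation u) fs >>= λ
    { (inj₁ zs) → let row≈0 = λ y → LC-zero (evaluation u) fs (h y) zs (λ e → e u) in
        return ([] , z≤n , λ y → lift λ x → trans (+-cong (*-congʳ (row≈0 u)) (-‿cong (*-congˡ (row≈0 y))))
          (solve 2 (λ a b → con (+ 0) :* a :- b :* con (+ 0) := con (+ 0)) refl (M x y) (M x u)))
    ; (inj₂ P) → return (Pivot.rest P , ℕₚ.≤-pred (≡.subst (ℕ._≤ suc r) (≡.sym (Pivot.rest-len P)) len) , column P) }
    where
    column : (P : Pivot (evaluation u) fs zeroSubspace) → ∀ y → LC zeroSubspace (Pivot.rest P) (λ x → reduce u M x y)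
    column P y = LC-rsp zeroSubspace rest
        (λ x → trans (+-congˡ (-‿cong (trans (*-congʳ b≈0) (zeroˡ (pivot x))))) (solve 1 (λ f → f :- con (+ 0) := f) refl (f x))) k
      where
      open Pivot P
      f : X → Carrier
      f x = reduce u M x y
      in-span : LC zeroSubspace (pivot ∷ rest) f
      in-span = LC-trans zeroSubspace (pivot ∷ rest) rest-span
        (LC-rsp zeroSubspace fs (λ x → +-congˡ (-‿cong (*-comm (M u y) (M x u))))
          (LC-sub zeroSubspace fs (M u y) (LC-scl zeroSubspace fs (M u u) (h y)) (h u)))
      b = proj₁ in-span
      k = proj₂ in-span
      -- At u both f and all of `rest` vanish, so b times the non-zero value of the pivot is zero.
      b≈0 : b ≈ 0#
      b≈0 = cancel-nonzero pivot≉0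
        (trans (solve 2 (λ m p → p := m :- (m :- p)) refl (f u) (b * pivot u))
        (trans (+-cong (-‿inverseʳ _) (-‿cong (LC-zero (evaluation u) rest k rest-zero (λ e → e u))))
          (-‿inverseʳ 0#)))

  rank-kills : ∀ r M → RankLe r M → Kills r M
  rank-kills zero M ([] , _ , h) x y = return (lower (h y) x)
  rank-kills (suc r) M h u = kills-stable r (reduce u M) (rank-reduce u h >>= λ k → return (rank-kills r (reduce u M) k))

module LDLRank {c ℓ : Level} (F : Field c ℓ) where
  open Field F hiding (zero)
  open FieldSolver F
  open LDL F
  open Sums F

  private
    prepend : ∀ {n} → Carrier → (Fin n → Carrier) → Fin (suc n) → Carrier
    prepend a f zero    = a
    prepend a f (suc i) = f i

  -- The columns of L span those of L D Lᵀ; they are (1, u) and the columns for the Schur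
  -- complement, extended by 0.
  columns : ∀ r n (v : Params r n) → ∃ λ fs → length fs ℕ.≤ r ×
    (∀ j → LinearAlgebra.LC F (Fin n) (LinearAlgebra.zeroSubspace F (Fin n)) fs (λ i → entry r n v i j))
  columns zero    n       v = [] , z≤n , λ j → lift λ i → refl
  columns (suc r) zero    v = [] , z≤n , λ ()
  columns (suc r) (suc n) (a , u , v) with columns r n v
  ... | fs , len , h = prepend 1# u ∷ map (prepend 0#) fs ,
    s≤s (≡.subst (ℕ._≤ r) (≡.sym (length-map (prepend 0#) fs)) len) , λ
    { zero    → a , LC-mem zeroSubspace (map (prepend 0#) fs) (lift λ
        { zero → solve 1 (λ a → a :- a :* con (+ 1) := con (+ 0)) refl a
        ; (suc i) → -‿inverseʳ (a * u i) })
    ; (suc j) → a * u j , LC-rsp zeroSubspace (map (prepend 0#) fs)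
        (λ { zero → solve 2 (λ a b → con (+ 0) := a :* b :- a :* b :* con (+ 1)) refl a (u j)
           ; (suc i) → solve 4 (λ a x y e → e := (a :* (x :* y) :+ e) :- a :* y :* x) refl a (u i) (u j) (entry r n v i j) })
        (LC-image F (prepend 0#) (λ { z zero → refl ; z (suc i) → z i })
          (λ { f b g zero → solve 1 (λ b → con (+ 0) := con (+ 0) :- b :* con (+ 0)) refl b ; f b g (suc i) → refl })
          fs (h j)) }
    where open LinearAlgebra F (Fin (suc n))

  rank-entry : ∀ r n (v : Params r n) → Reduction.RankLe F (Fin n → Carrier) r (bilinear (entry r n v))
  rank-entry r n v with columns r n v
  ... | fs , len , h = map (λ f x → dot x f) fs , ≡.subst (ℕ._≤ r) (≡.sym (length-map _ fs)) len , λ y →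
    LC-∑ n y λ j → LC-image F (λ f x → dot x f) (λ z x → dot-zero x z) (λ f b g x → dot-sub x f b g) fs (h j)
    where
    open LinearAlgebra F (Fin n → Carrier)
    gs = map (λ f x → dot x f) fs
    LC-∑ : ∀ m (y : Fin m → Carrier) {f : Fin m → Fn} → (∀ j → LC zeroSubspace gs (f j)) →
      LC zeroSubspace gs (λ x → ∑ m (λ j → y j * f j x))
    LC-∑ zero    y k = LC-zer zeroSubspace gs
    LC-∑ (suc m) y k = LC-add zeroSubspace gs (LC-scl zeroSubspace gs (y zero) (k zero)) (LC-∑ m (λ j → y (suc j)) (λ j → k (suc j)))

-- Diagonalisation, and squares combined into products.

module Diagonalisation {c ℓ : Level} (F : Field c ℓ) (2≉0 : ¬ Field._≈_ F (Field._+_ F (Field.1# F) (Field.1# F)) (Field.0# F)) where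
  open Field F hiding (zero)
  open FieldSolver F
  open FieldLemmas F
  open Sums F

  SumOfSquares : ∀ {n} → ℕ → (Fin n → Fin n → Carrier) → Set (c ⊔ ℓ)
  SumOfSquares {n} r A = Σ (Fin r → Carrier) λ α → Σ (Fin r → Fin n → Carrier) λ l →
    ∀ i j → A i j ≈ ∑ r (λ a → α a * (l a i * l a j))

  module _ {n : ℕ} where
    open Reduction F (Fin n → Carrier)

    -- Lagrange's method: when `M u u` is non-zero, M is its inverse times the sum of M(x, u) M(u,
    -- y) and `reduce u M`. The first term gives one scaled square, and induction applies to the
    -- second.
    diagonalise : ∀ r (M : Form) → (∀ x y → M x y ≈ M y x) →
      (∀ x y z → M (λ i → x i + y i) z ≈ M x z + M y z) → Kills r M →
      ∀ {m} (e : Fin m → Fin n → Carrier) → ¬ ¬ SumOfSquares r (λ i j → M (e i) (e j))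
    diagonalise zero M M-sym M-add kills {m} e =
      ¬¬-Fin m (λ i → ¬¬-Fin m (λ j → kills (e i) (e j))) >>= λ z → return ((λ ()) , (λ ()) , z)
    diagonalise (suc r) M M-sym M-add kills {m} e = lem (∃ λ u → ¬ M u u ≈ 0#) >>= λ
      { (inj₁ (u , nz)) → let w , wm≈1 = divide nz 1# in
          diagonalise r (reduce u M)
            (λ x y → +-cong (*-congˡ (M-sym x y)) (-‿cong (trans (*-comm _ _) (*-cong (M-sym u y) (M-sym x u)))))
            (λ x y z → trans (+-cong (*-congˡ (M-add x y z)) (-‿cong (*-congʳ (M-add x y u))))
              (solve 6 (λ m a b p q s → m :* (a :+ b) :- (p :+ q) :* s := (m :* a :- p :* s) :+ (m :* b :- q :* s))
                refl (M u u) (M x z) (M y z) (M x u) (M y u) (M u z)))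
            (kills u) e >>= λ { (α , l , eq) → return
              ( (λ { zero → w ; (suc a) → w * α a }) , (λ { zero i → M (e i) u ; (suc a) i → l a i }) , λ i j →
                trans (sym (trans (*-congʳ wm≈1) (*-identityˡ _)))
                (trans (solve 5 (λ w m x p q → (w :* m) :* x := w :* (p :* q) :+ w :* (m :* x :- p :* q))
                         refl w (M u u) (M (e i) (e j)) (M (e i) u) (M u (e j)))
                (+-cong (*-congˡ (*-congˡ (M-sym u (e j))))
                  (trans (*-congˡ (eq i j)) (trans (sym (∑-scl r w _)) (∑-cong r (λ a → sym (*-assoc _ _ _)))))))) }
      -- All `M u u` vanish, so by polarisation the whole matrix does, and zero squares make up the
      -- r + 1 terms.
      ; (inj₂ none) → let diag : ∀ u → ¬ ¬ M u u ≈ 0#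
                          diag u nz = none (u , nz) in
          ¬¬-Fin m (λ i → ¬¬-Fin m (λ j →
            diag (λ k → e i k + e j k) >>= λ z → diag (e i) >>= λ zi → diag (e j) >>= λ zj →
            return (polarise (e i) (e j) z zi zj))) >>= λ z →
          return ((λ _ → 0#) , (λ _ _ → 0#) , λ i j →
            trans (z i j) (sym (trans (∑-cong (suc r) (λ _ → zeroˡ (0# * 0#))) (∑-zero (suc r))))) }
      where
      polarise : ∀ x y → M (λ k → x k + y k) (λ k → x k + y k) ≈ 0# → M x x ≈ 0# → M y y ≈ 0# → M x y ≈ 0#
      polarise x y z zx zy = cancel-nonzero 2≉0 (trans
        (solve 2 (λ a b → a :* (con (+ 1) :+ con (+ 1)) := (con (+ 0) :+ a) :+ (a :+ con (+ 0))) refl (M x y) 0#)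
        (trans (+-cong (+-cong (sym zx) (M-sym x y)) (+-cong refl (sym zy))) (trans (sym expand) z)))
        where
        expand : M (λ k → x k + y k) (λ k → x k + y k) ≈ (M x x + M y x) + (M x y + M y y)
        expand = trans (M-add x y _) (+-cong (trans (M-sym x _) (M-add x y x)) (trans (M-sym y _) (M-add x y y)))

-- If 2 vanished in F, only even multiples of 1 could vanish, so the prime p would be even.
two-nonzero : ∀ {c ℓ} (F : Field c ℓ) → OddCharacteristic F → let open Field F in ¬ (1# + 1# ≈ 0#)
two-nonzero F (p , p-prime , p≢2 , p≈0) 2≈0 = [ (λ ()) , (λ e → p≢2 (≡.sym e)) ]′ (prime⇒irreducible p-prime (even p p≈0))
  where
  open Field F hiding (zero)
  even : ∀ m → ℕ→F F m ≈ 0# → 2 ∣ m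
  even zero          _  = 2 ∣0
  even (suc zero)    e  = ⊥-elim (1≉0 (trans (sym (+-identityʳ 1#)) e))
  even (suc (suc m)) e with even m (trans (sym (+-identityˡ _)) (trans (+-congʳ (sym 2≈0)) (trans (+-assoc _ _ _) e)))
  ... | divides k eq = divides (suc k) (≡.cong (λ x → suc (suc x)) eq)

-- From four scaled squares to two products of linear forms.

module Products {c ℓ : Level} (F : Field c ℓ) (closed : AlgClosed F) where
  open Field F hiding (zero)
  open FieldSolver F
  open Sums F
  open FieldLemmas F

  -- The coefficients of the quadratic form xᵀAx.
  toQuad : ∀ {n} → (Fin n → Fin n → Carrier) → Quad F n
  toQuad A i j with i Fin.≟ j
  ... | yes _ = A i i
  ... | no  _ = A i j + A j i

  sqrt : ∀ a → ∃ λ s → s * s ≈ a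
  sqrt a with closed 1 (λ { zero → - a ; (suc _) → 0# })
  ... | s , eq = s , difference-zero (trans
    (solve 2 (λ s a → s :* s :- a := s :* (s :* con (+ 1)) :+ ((:- a) :* con (+ 1) :+ (con (+ 0) :* (s :* con (+ 1)) :+ con (+ 0))))
      refl s a) eq)

  -- αx² + βy² is the product of sx + ty and sx - ty, where s² = α and t² = -β.
  squares-products : ∀ {n} {A : Fin n → Fin n → Carrier} (α : Fin 4 → Carrier) (l : Fin 4 → Fin n → Carrier) →
    (∀ i j → A i j ≈ ∑ 4 (λ a → α a * (l a i * l a j))) → SumOfProducts F 2 (toQuad A)
  squares-products {n} {A} α l eq = left , right , λ i j _ → main i j
    where
    s t : Fin 4 → Carrier
    s a = proj₁ (sqrt (α a))
    t a = proj₁ (sqrt (- α a))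
    plus minus : Fin 4 → Fin 4 → Lin F n
    plus  a b i = s a * l a i + t b * l b i
    minus a b i = s a * l a i - t b * l b i
    left right : Fin 2 → Lin F n
    left  zero = plus  (# 0) (# 1) ; left  (suc _) = plus  (# 2) (# 3)
    right zero = minus (# 0) (# 1) ; right (suc _) = minus (# 2) (# 3)
    pair : ∀ a b i j → plus a b i * minus a b j + plus a b j * minus a b i ≈
      (α a * (l a i * l a j) + α b * (l b i * l b j)) + (α a * (l a j * l a i) + α b * (l b j * l b i))
    pair a b i j = trans
      (solve 6 (λ s t x y z w → (s :* x :+ t :* y) :* (s :* z :- t :* w) :+ (s :* z :+ t :* w) :* (s :* x :- t :* y)
          := ((s :* s) :* (x :* z) :+ (:- (t :* t)) :* (y :* w)) :+ ((s :* s) :* (z :* x) :+ (:- (t :* t)) :* (w :* y)))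
        refl (s a) (t b) (l a i) (l b i) (l a j) (l b j))
      (+-cong (+-cong (*-congʳ s²) (*-congʳ t²)) (+-cong (*-congʳ s²) (*-congʳ t²)))
      where
      s² = proj₂ (sqrt (α a))
      t² : - (t b * t b) ≈ α b
      t² = trans (-‿cong (proj₂ (sqrt (- α b)))) (solve 1 (λ a → :- (:- a) := a) refl (α b))
    single : ∀ a b i → plus a b i * minus a b i ≈ α a * (l a i * l a i) + α b * (l b i * l b i)
    single a b i = trans
      (solve 4 (λ s t x y → (s :* x :+ t :* y) :* (s :* x :- t :* y)
          := (s :* s) :* (x :* x) :+ (:- (t :* t)) :* (y :* y))
        refl (s a) (t b) (l a i) (l b i))
      (+-cong (*-congʳ (proj₂ (sqrt (α a))))
        (*-congʳ (trans (-‿cong (proj₂ (sqrt (- α b)))) (solve 1 (λ a → :- (:- a) := a) refl (α b)))))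
    main : ∀ i j → toQuad A i j ≈ ΣQ F 2 (λ k → mulLin F (left k) (right k)) i j
    main i j with i Fin.≟ j
    ... | yes _ = trans (eq i i) (trans
          (solve 4 (λ a b x y → a :+ (b :+ (x :+ (y :+ con (+ 0)))) := (a :+ b) :+ ((x :+ y) :+ con (+ 0))) refl _ _ _ _)
          (sym (+-cong (single (# 0) (# 1) i) (+-congʳ (single (# 2) (# 3) i)))))
    ... | no  _ = trans (+-cong (eq i j) (eq j i)) (trans
          (solve 8 (λ a b x y a′ b′ x′ y′ → (a :+ (b :+ (x :+ (y :+ con (+ 0))))) :+ (a′ :+ (b′ :+ (x′ :+ (y′ :+ con (+ 0)))))
              := ((a :+ b) :+ (a′ :+ b′)) :+ (((x :+ y) :+ (x′ :+ y′)) :+ con (+ 0))) refl _ _ _ _ _ _ _ _)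
          (sym (+-cong (pair (# 0) (# 1) i j) (+-congʳ (pair (# 2) (# 3) i j)))))

¬¬-All : ∀ {a p} {A : Set a} {P : A → Set p} xs → All (λ x → ¬ ¬ P x) xs → ¬ ¬ All P xs
¬¬-All []       []       = return []
¬¬-All (x ∷ xs) (h ∷ hs) = h >>= λ p → ¬¬-All xs hs >>= λ ps → return (p ∷ ps)

-- The number of coefficients of a quadratic form, and the numerical bound.

triangle : ℕ → ℕ
triangle zero    = 0
triangle (suc n) = suc n ℕ.+ triangle n

upperPairs : ∀ n → List (Fin n × Fin n)
upperPairs zero    = []
upperPairs (suc n) = map (zero ,_) (allFin (suc n)) ++ map (λ { (i , j) → suc i , suc j }) (upperPairs n)

upperPairs-length : ∀ n → length (upperPairs n) ≡ triangle n
upperPairs-length zero    = ≡.refl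
upperPairs-length (suc n) = ≡.trans (length-++ (map (zero ,_) (allFin (suc n))))
  (≡.cong₂ ℕ._+_ (≡.trans (length-map _ (allFin (suc n))) (length-tabulate (λ x → x)))
    (≡.trans (length-map _ (upperPairs n)) (upperPairs-length n)))

upperPairs-complete : ∀ n (i j : Fin n) → i Fin.≤ j → (i , j) ∈ upperPairs n
upperPairs-complete (suc n) zero    j       _        = ∈-++⁺ˡ (∈-map⁺ (zero ,_) (∈-allFin j))
upperPairs-complete (suc n) (suc i) (suc j) (s≤s le) =
  ∈-++⁺ʳ (map (zero ,_) (allFin (suc n))) (∈-map⁺ (λ { (i , j) → suc i , suc j }) (upperPairs-complete n i j le))

module Bound where
  open import Data.Nat using (_+_; _*_; _∸_; _≤_; _/_)

  triangle-formula : ∀ n → n * suc n / 2 ≡ triangle n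
  triangle-formula n = ≡.trans (≡.cong (_/ 2) (double n)) (DivMod.m*n/n≡m (triangle n) 2)
    where
    open Data.Nat.Solver.+-*-Solver using (solve; _:=_; _:*_; _:+_; con)
    double : ∀ n → n * suc n ≡ triangle n * 2
    double zero    = ≡.refl
    double (suc n) = ≡.trans
      (solve 1 (λ n → (con 1 :+ n) :* (con 2 :+ n) := (con 1 :+ n) :* con 2 :+ n :* (con 1 :+ n)) ≡.refl n)
      (≡.trans (≡.cong (λ x → suc n * 2 + x) (double n)) (≡.sym (ℕₚ.*-distribʳ-+ 2 (suc n) (triangle n))))

  -- Equality holds from n = 3 on. Smaller matrices have full rank below three, and the dimension of
  -- the variety then exceeds 4n - 6.
  dim-bound : ∀ n → 4 * n ≤ dim 4 n + 6
  dim-bound 0 = z≤n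
  dim-bound 1 = ℕₚ.m≤m+n 4 3
  dim-bound 2 = ℕₚ.m≤m+n 8 1
  dim-bound 3 = ℕₚ.≤-refl
  dim-bound (suc (suc (suc (suc n)))) = ℕₚ.≤-reflexive (solve 1 (λ n →
      con 4 :* (con 4 :+ n) := (con 4 :+ n) :+ ((con 3 :+ n) :+ ((con 2 :+ n) :+ ((con 1 :+ n) :+ con 0))) :+ con 6) ≡.refl n)
    where open Data.Nat.Solver.+-*-Solver using (solve; _:=_; _:*_; _:+_; con)

  integer-bound : ∀ n k → k + dim 4 n ≤ triangle n → + k ℤ.≤ bound8p1 n
  integer-bound n k h = begin
    + k                                              ≡⟨ solve 2 (λ k a → k := (k :+ a) :- a) ≡.refl (+ k) (+ (4 * n)) ⟩
    + (k + 4 * n) ℤ.- + (4 * n)                      ≤⟨ ℤₚ.+-monoˡ-≤ (ℤ.- + (4 * n)) (ℤ.+≤+ natural) ⟩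
    + (triangle n + 6) ℤ.- + (4 * n)                 ≡⟨ solve 2 (λ t a → (t :+ con (+ 6)) :- a := t :- (a :- con (+ 6))) ≡.refl (+ triangle n) (+ (4 * n)) ⟩
    + triangle n ℤ.- (+ (4 * n) ℤ.- + 6)             ≡⟨ ≡.cong (λ t → + t ℤ.- (+ (4 * n) ℤ.- + 6)) (triangle-formula n) ⟨
    bound8p1 n                                       ∎
    where
    open ℤₚ.≤-Reasoning
    open Data.Integer.Solver.+-*-Solver using (solve; _:=_; _:-_; _:+_; con)
    natural : k + 4 * n ≤ triangle n + 6
    natural = ℕₚ.≤-trans (ℕₚ.+-monoʳ-≤ k (dim-bound n))
      (ℕₚ.≤-trans (ℕₚ.≤-reflexive (≡.sym (ℕₚ.+-assoc k (dim 4 n) 6))) (ℕₚ.+-monoˡ-≤ 6 h))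

-- Linear equations for a space of quadratic forms.

module Annihilators {c ℓ : Level} (F : Field c ℓ) (n : ℕ) where
  open Field F hiding (zero)
  open FieldSolver F
  open FieldLemmas F
  open Sums F

  Pairs : Set
  Pairs = Fin n × Fin n

  open LinearAlgebra F Pairs

  pairing : Fn → Fn → Carrier
  pairing β Q = ∑ n (λ i → ∑ n (λ j → β (i , j) * Q (i , j)))

  pairing-comm : ∀ β Q → pairing β Q ≈ pairing Q β
  pairing-comm β Q = ∑-cong n (λ i → ∑-cong n (λ j → *-comm _ _))

  pairing-zero : ∀ β {Q} → Q ≐ (λ _ → 0#) → pairing β Q ≈ 0#
  pairing-zero β z = trans (∑-cong n (λ i → dot-zero (λ j → β (i , j)) (λ j → z (i , j)))) (∑-zero n)

  pairing-sub : ∀ β f b g → pairing β (λ w → f w - b * g w) ≈ pairing β f - b * pairing β g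
  pairing-sub β f b g = trans (∑-cong n (λ i → dot-sub (λ j → β (i , j)) (λ j → f (i , j)) b (λ j → g (i , j)))) (∑-sub n _ _)
    where
    ∑-sub : ∀ m (p q : Fin m → Carrier) → ∑ m (λ i → p i - b * q i) ≈ ∑ m p - b * ∑ m q
    ∑-sub m p q = trans (∑-cong m (λ i → solve 3 (λ p b q → p :- b :* q := p :+ (:- b) :* q) refl (p i) b (q i)))
      (trans (∑-add m p _) (trans (+-congˡ (∑-scl m (- b) q))
        (solve 3 (λ p b q → p :+ (:- b) :* q := p :- b :* q) refl _ b _)))

  pairWith : Fn → Functional
  pairWith Q = record
    { apply = λ β → pairing β Q
    ; sub   = λ f b g → trans (pairing-comm _ Q) (trans (pairing-sub Q f b g)
                (+-cong (pairing-comm Q f) (-‿cong (*-congˡ (pairing-comm Q g))))) }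

  pairWith-zero : ∀ Q {β} → β ≐ (λ _ → 0#) → pairing β Q ≈ 0#
  pairWith-zero Q {β} z = trans (pairing-comm β Q) (pairing-zero Q z)

  delta : Pairs → Fn
  delta (i , j) (k , l) = basis i k * basis j l

  pairing-delta : ∀ i j Q → pairing (delta (i , j)) Q ≈ Q (i , j)
  pairing-delta i j Q = trans
    (∑-cong n (λ k → trans (∑-cong n (λ l → *-assoc _ _ _)) (trans (∑-scl n (basis i k) _)
      (*-congˡ (dot-basis j (λ l → Q (k , l)))))))
    (dot-basis i (λ k → Q (k , j)))

  -- Only the entries Q (i , j) with i ≤ j carry information.
  nullForms : Subspace
  nullForms = record
    { mem   = λ Q → Lift c (∀ i j → i Fin.≤ j → Q (i , j) ≈ 0#)
    ; ∈-rsp = λ { e (lift h) → lift λ i j le → trans (sym (e (i , j))) (h i j le) }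
    ; ∈-zer = lift λ i j le → refl
    ; ∈-add = λ { (lift h) (lift k) → lift λ i j le → trans (+-cong (h i j le) (k i j le)) (+-identityˡ 0#) }
    ; ∈-scl = λ { b (lift h) → lift λ i j le → trans (*-congˡ (h i j le)) (zeroʳ b) } }

  Annihilates : List Fn → List Fn → Set (c ⊔ ℓ)
  Annihilates βs fs = ∀ Q → All (λ β → pairing β Q ≈ 0#) βs → LC nullForms fs Q

  -- Induction on fs: the coordinate functionals cut out the zero space, and each further
  -- independent f costs one equation, which is used to make the others vanish at f.
  annihilators : ∀ fs → ¬ Dep nullForms fs → ¬ ¬ ∃ λ βs → length fs ℕ.+ length βs ≡ triangle n × Annihilates βs fs
  annihilators [] _ = return (map delta (upperPairs n) ,
    ≡.trans (length-map delta (upperPairs n)) (upperPairs-length n) ,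
    λ Q zs → lift λ i j le → trans (sym (pairing-delta i j Q))
      (All.lookup (Allₚ.map⁻ zs) (upperPairs-complete n i j le)))
  annihilators (f ∷ fs) indep = annihilators fs (λ d → indep (inj₂ d)) >>= λ { (βs , len , ann) →
    split zeroSubspace (pairWith f) βs >>= λ
      -- If f satisfied all equations, it would lie in the span of fs.
      { (inj₁ zs) → λ _ → indep (inj₁ (ann f zs))
      ; (inj₂ P) → return (Pivot.rest P ,
          ≡.trans (≡.sym (ℕₚ.+-suc (length fs) _)) (≡.trans (≡.cong (length fs ℕ.+_) (Pivot.rest-len P)) len) ,
          extend βs ann P) } }
    where
    extend : ∀ βs → Annihilates βs fs → (P : Pivot (pairWith f) βs zeroSubspace) → Annihilates (Pivot.rest P) (f ∷ fs)
    extend βs ann P Q zs = d , ann y (All.map (λ {β} k → LC-zero (pairWith y) (pivot ∷ rest) {β} k (pivot-y ∷ rest-y rest zs rest-zero)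
        (λ {β} → pairWith-zero y {β})) rest-span)
      where
      open Pivot P
      -- This multiple of f makes the pivot equation hold for y; the equations in `rest` hold for
      -- both Q and f.
      d = proj₁ (divide pivot≉0 (pairing pivot Q))
      y : Fn
      y w = Q w - d * f w
      pivot-y : pairing pivot y ≈ 0#
      pivot-y = trans (pairing-sub pivot Q d f) (trans (+-congˡ (-‿cong (proj₂ (divide pivot≉0 (pairing pivot Q))))) (-‿inverseʳ _))
      rest-y : ∀ gs → All (λ β → pairing β Q ≈ 0#) gs → All (λ β → pairing β f ≈ 0#) gs → All (λ β → pairing β y ≈ 0#) gs
      rest-y []       []       []         = []
      rest-y (g ∷ gs) (z ∷ zs) (z′ ∷ zs′) = trans (pairing-sub g Q d f)
        (trans (+-cong z (-‿cong (trans (*-congˡ z′) (zeroʳ d)))) (-‿inverseʳ 0#)) ∷ rest-y gs zs zs′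

  LC-coefficients : ∀ k (Qs : Fin k → Fn) {f} → LC nullForms (tabulate Qs) f →
    ∃ λ (μ : Fin k → Carrier) → Subspace.mem nullForms (λ w → f w - ∑ k (λ t → μ t * Qs t w))
  LC-coefficients zero    Qs {f} h = (λ ()) , Subspace.∈-rsp nullForms (λ w → solve 1 (λ f → f := f :- con (+ 0)) refl (f w)) h
  LC-coefficients (suc k) Qs {f} (b , h) with LC-coefficients k (λ t → Qs (suc t)) h
  ... | μ , m = (λ { zero → b ; (suc t) → μ t }) , Subspace.∈-rsp nullForms
    (λ w → solve 4 (λ f b g s → (f :- b :* g) :- s := f :- (b :* g :+ s)) refl (f w) b (Qs zero w) _) m

  Dep-coefficients : ∀ k (Qs : Fin k → Fn) → Dep nullForms (tabulate Qs) →
    ∃ λ (μ : Fin k → Carrier) → Subspace.mem nullForms (λ w → ∑ k (λ t → μ t * Qs t w)) × ∃ λ t → μ t ≈ 1#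
  Dep-coefficients (suc k) Qs (inj₁ h) with LC-coefficients k (λ t → Qs (suc t)) h
  ... | μ , m = (λ { zero → 1# ; (suc t) → - 1# * μ t }) , Subspace.∈-rsp nullForms
    (λ w → trans (solve 2 (λ f s → f :- s := con (+ 1) :* f :+ (:- con (+ 1)) :* s) refl (Qs zero w) _)
      (+-congˡ (trans (sym (∑-scl k (- 1#) _)) (∑-cong k (λ t → sym (*-assoc _ _ _)))))) m , zero , refl
  Dep-coefficients (suc k) Qs (inj₂ h) with Dep-coefficients k (λ t → Qs (suc t)) h
  ... | μ , m , t , e = (λ { zero → 0# ; (suc t) → μ t }) , Subspace.∈-rsp nullForms
    (λ w → solve 2 (λ f s → s := con (+ 0) :* f :+ s) refl (Qs zero w) _) m , suc t , e

-- The point on the linear section, and the dimension bound.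

module Main {c ℓ p : Level} (F : Field c ℓ) (closed : AlgClosed F) (odd : OddCharacteristic F) (n : ℕ)
    (C : Quad F n → Set p) (subspace : IsSubspace F n C)
    (weight≥3 : ∀ Q → C Q → ¬ (_≈Q_ F Q (0Q F)) → WtGe F 3 Q) where
  open Field F hiding (zero)
  open FieldSolver F
  open FieldLemmas F
  open Sums F
  open Products F closed
  open LDL F
  open RankVariety F closed 4 n
  open Annihilators F n
  open Diagonalisation F (two-nonzero F odd)
  open Reduction F (Fin n → Carrier)
  open LinearAlgebra F using (LC; Dep; Subspace)
  open IsSubspace subspace

  LC-closed : ∀ fs → All (λ f → C (λ i j → f (i , j))) fs → ∀ {Q} → LC Pairs nullForms fs Q → C (λ i j → Q (i , j))
  LC-closed []       []       (lift h) = respects (λ i j le → sym (h i j le)) has-0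
  LC-closed (f ∷ fs) (hf ∷ hs) {Q} (b , h) =
    respects (λ i j _ → solve 3 (λ q b f → (q :- b :* f) :+ b :* f := q) refl (Q (i , j)) b (f (i , j)))
      (closed-+ (LC-closed fs hs {λ w → Q w - b * f w} h) (closed-· b hf))

  genericQuad : (Fin n → Fin n → Carrier) → Pairs → Carrier
  genericQuad A (i , j) = toQuad A i j

  -- An equation for quadratic forms, read as a linear form in the matrix entries: a hyperplane
  -- section of V.
  linearForm : (Pairs → Carrier) → V → Carrier
  linearForm β v = pairing β (genericQuad (entry 4 n v))

  S-∑ : ∀ {d} m {f : Fin m → V → Carrier} → (∀ i → S d (f i)) → S d (λ v → ∑ m (λ i → f i v))
  S-∑ zero    h = zer
  S-∑ (suc m) h = add (h zero) (S-∑ m (λ i → h (suc i)))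

  S-toQuad : ∀ i j → S 1 (λ v → toQuad (entry 4 n v) i j)
  S-toQuad i j with i Fin.≟ j
  ... | yes _ = S-gen (i , i)
  ... | no  _ = add (S-gen (i , j)) (S-gen (j , i))

  S-linearForm : ∀ β → S 1 (linearForm β)
  S-linearForm β = S-∑ n λ i → S-∑ n λ j → scl (β (i , j)) (S-toQuad i j)

  module _ (βs : List (Pairs → Carrier)) (P : Point (relations ⊕* map linearForm βs)) where
    open AtPoint P
    open Point P using (coord)

    private
      A : Fin n → Fin n → Carrier
      A i j = coord (i , j)

      K = relations ⊕* map linearForm βs

      value-∑ : ∀ {d} m {f : Fin m → V → Carrier} {a : Fin m → Carrier} → (∀ i → Value d (f i) (a i)) →
        Value d (λ v → ∑ m (λ i → f i v)) (∑ m a)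
      value-∑ zero    h = value-zer
      value-∑ (suc m) h = value-add (h zero) (value-∑ m (λ i → h (suc i)))

      value-toQuad : ∀ i j → Value 1 (λ v → toQuad (entry 4 n v) i j) (toQuad A i j)
      value-toQuad i j with i Fin.≟ j
      ... | yes _ = value-gen (i , i)
      ... | no  _ = value-add (value-gen (i , j)) (value-gen (j , i))

      value-linearForm : ∀ β → Value 1 (linearForm β) (pairing β (genericQuad A))
      value-linearForm β = value-∑ n λ i → value-∑ n λ j → value-scl (β (i , j)) (value-toQuad i j)

      value-bilinear : ∀ x y → Value 1 (λ v → bilinear (entry 4 n v) x y) (bilinear A x y)
      value-bilinear x y = value-∑ n λ j → value-scl (y j) (value-∑ n λ i → value-scl (x i) (value-gen (i , j)))

      -- Each `reduce` is a polynomial in values of the form, so its value at the point is computed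
      -- by the same formula, with the degree doubled.
      kills-transfer : ∀ r {d} (M : V → Form) (N : Form) → (∀ x y → Value d (λ v → M v x y) (N x y)) →
        (∀ v → Kills r (M v)) → Kills r N
      kills-transfer zero M N val k x y = value-∈ (val x y) (⊑-⊕* relations (map linearForm βs) _ _ (λ v → k v x y))
      kills-transfer (suc r) {d} M N val k u = kills-transfer r {d ℕ.+ d} (λ v → reduce u (M v)) (reduce u N)
        (λ x y → value-rsp
          (λ v → solve 2 (λ a b → a :+ (:- con (+ 1)) :* b := a :- b) refl (M v u u * M v x y) (M v x u * M v u y))
          (solve 2 (λ a b → a :+ (:- con (+ 1)) :* b := a :- b) refl (N u u * N x y) (N x u * N u y))
          (value-add (value-mul (val u u) (val x y)) (value-scl (- 1#) (value-mul (val x u) (val u y)))))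
        (λ v → k v u)

      A-kills : Kills 4 (bilinear A)
      A-kills = kills-transfer 4 (λ v → bilinear (entry 4 n v)) (bilinear A) value-bilinear
        λ v → rank-kills 4 (bilinear (entry 4 n v)) (LDLRank.rank-entry F 4 n v)

      A-symmetric : ¬ ¬ (∀ i j → A i j ≈ A j i)
      A-symmetric = ¬¬-Fin n λ i → ¬¬-Fin n λ j →
        value-∈ (value-add (value-gen (i , j)) (value-scl (- 1#) (value-gen (j , i))))
          (⊑-⊕* relations (map linearForm βs) 1 _ λ v → return
            (trans (+-congʳ (entry-sym 4 n v i j)) (solve 1 (λ a → a :+ (:- con (+ 1)) :* a := con (+ 0)) refl (entry 4 n v j i))))
        >>= λ z → return (difference-zero
          (trans (solve 2 (λ a b → a :- b := a :+ (:- con (+ 1)) :* b) refl (A i j) (A j i)) z))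

      A-annihilated : ¬ ¬ All (λ β → pairing β (genericQuad A) ≈ 0#) βs
      A-annihilated = ¬¬-All βs (All.map (λ {β} h → value-∈ (value-linearForm β) h)
        (Allₚ.map⁻ (∈-⊕* relations (map linearForm βs))))

      A-products : ¬ ¬ SumOfProducts F 2 (toQuad A)
      A-products = A-symmetric >>= λ A-sym →
        diagonalise 4 (bilinear A) (bilinear-sym A A-sym) (bilinear-addˡ A) A-kills basis >>= λ { (α , l , eq) →
          return (squares-products α l (λ i j → trans (sym (bilinear-basis A i j)) (eq i j))) }

      -- By symmetry the coefficients off the diagonal are 2A i j, and 2 is invertible.
      toQuad-zero : (∀ i j → A i j ≈ A j i) → _≈Q_ F (toQuad A) (0Q F) → ∀ i j → A i j ≈ 0#
      toQuad-zero A-sym z i j = [ (λ le → upper i j le (z i j le)) , (λ le → trans (A-sym i j) (upper j i le (z j i le))) ]′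
        (ℕₚ.≤-total (toℕ i) (toℕ j))
        where
        upper : ∀ i j → i Fin.≤ j → toQuad A i j ≈ 0# → A i j ≈ 0#
        upper i j le e with i Fin.≟ j
        ... | yes ≡.refl = e
        ... | no  _      = cancel-nonzero (two-nonzero F odd) (trans
          (solve 1 (λ a → a :* (con (+ 1) :+ con (+ 1)) := a :+ a) refl (A i j)) (trans (+-congˡ (A-sym i j)) e))

    -- The form of A satisfies the equations and so lies in C; it is non-zero because the
    -- coordinates are, and it is a sum of two products, against weight at least 3.
    no-point : ∀ {fs} → Annihilates βs fs → All (λ f → C (λ i j → f (i , j))) fs → ⊥
    no-point {fs} ann hfs = (A-symmetric >>= λ A-sym → A-annihilated >>= λ zs → A-products >>= λ products →
      return (weight≥3 (toQuad A) (LC-closed fs hfs {genericQuad A} (ann (genericQuad A) zs))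
        (λ z → coord-nonzero λ { (i , j) → toQuad-zero A-sym z i j }) 2 ℕₚ.≤-refl products)) λ x → x

  -- A cone of dimension m + 1 meets m hyperplanes outside its vertex, so at most m equations would
  -- leave a point, which `no-point` excludes.
  codimension : ∀ βs {fs} → Annihilates βs fs → All (λ f → C (λ i j → f (i , j))) fs → dim 4 n ℕ.≤ length βs
  codimension βs ann hfs with dim 4 n in eq
  ... | zero  = z≤n
  ... | suc m = decidable-stable (suc m ℕ.≤? length βs) λ ≰ →
    (section-nonVanishing eq (map linearForm βs) (Allₚ.map⁺ (All.tabulate λ {β} _ → S-linearForm β))
      (ℕₚ.≤-trans (ℕₚ.≤-reflexive (length-map linearForm βs)) (ℕₚ.≤-pred (ℕₚ.≰⇒> ≰))) >>= λ nv →
    nullstellensatz (relations ⊕* map linearForm βs) nv >>= λ P → return (no-point βs P ann hfs)) λ x → x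

  -- The span of the k forms is cut out by `triangle n` - k equations, to which `codimension`
  -- applies.
  dimension : ∀ k (Qs : Fin k → Quad F n) → (∀ t → C (Qs t)) → LinIndep F k Qs → k ℕ.+ dim 4 n ℕ.≤ triangle n
  dimension k Qs hQs indep = decidable-stable (_ ℕ.≤? _)
    (annihilators fs independent >>= λ { (βs , len , ann) → return
      (ℕₚ.≤-trans (ℕₚ.+-mono-≤ (ℕₚ.≤-reflexive (≡.sym (length-tabulate (λ t → uncurry (Qs t)))))
        (codimension βs ann (Allₚ.tabulate⁺ hQs))) (ℕₚ.≤-reflexive len)) })
    where
    fs = tabulate (λ t → uncurry (Qs t))
    independent : ¬ Dep Pairs nullForms fs
    independent dep with Dep-coefficients k (λ t → uncurry (Qs t)) dep
    ... | μ , lift h , t , μt≈1 = 1≉0 (trans (sym μt≈1) (indep μ h t))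

theorem8p1 : ∀ {c ℓ p : Level} (F : Field c ℓ) → AlgClosed F → OddCharacteristic F →
    (n : ℕ) (C : Quad F n → Set p) → IsSubspace F n C →
    (∀ Q → C Q → ¬ (_≈Q_ F Q (0Q F)) → WtGe F 3 Q) →
    DimLe F C (bound8p1 n)
theorem8p1 F closed odd n C subspace weight≥3 k Qs hQs indep =
  Bound.integer-bound n k (Main.dimension F closed odd n C subspace weight≥3 k Qs hQs indep)
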